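{- Let $\mathcal{E}$ be a natural $t$-efficient error metric. There is a deterministic algorithm $\mathcal{A}_{\mathrm{InstanceOpt},\mathcal{E}}$ with the following guarantee. Given as input a $q$-query RDT $R$ over $n$ variables with description length $N$ and an error parameter $\varepsilon\in(0,1)$, let $$q^\star_{R,\mathcal{E}}:=\min\{\,q' : \text{there is a } q'\text{ -query DDT } D \text{ such that } \mathcal{E}(R,D)\le\varepsilon\,\}.$$ Then $\mathcal{A}_{\mathrm{InstanceOpt},\mathcal{E}}$ runs in time $\mathrm{poly}(N,t,n^{q^\star_{R,\mathcal{E}}})$ and returns a $q^\star_{R,\mathcal{E}}$-query DDT $D$ satisfying $\mathcal{E}(R,D)\le\varepsilon$.
   Context: An $n$-variable randomized decision tree (RDT) is a binary tree with two types of internal nodes: decision nodes, which branch on the value of one of the boolean variables $x_1,\dots,x_n$, and stochastic nodes, which branch on the outcome of an independent $\mathrm{Bernoulli}(\frac12)$ random bit. Leaves are labelled by values in $[0,1]$. Its query complexity is the maximum number of decision nodes on any root-to-leaf path, and its randomness complexity is the maximum number $m$ of stochastic nodes on any root-to-leaf path; it is $q$-query if its query complexity is at most $q$. The RDT computes a function $R:\{0,1\}^n\times\{0,1\}^m\to[0,1]$, where $R(x,r)$ is the label of the leaf reached on input $x$ when the stochastic nodes encountered branch according to the bits of $r$. Its mean function is $\mu_R(x)=\mathbb{E}_{r\sim\{0,1\}^m}[R(x,r)]$ ($r$ uniform). A deterministic decision tree (DDT) is an RDT with no stochastic nodes, computing $D:\{0,1\}^n\to[0,1]$. The description length is the length of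 the description of the tree. An error metric is a map $\mathcal{E}:\{\text{RDTs}\}\times\{\text{DDTs}\}\to[0,1]$. It is natural if there is some $d:[0,1]\times[0,1]\to[0,1]$ such that $\mathcal{E}(R,D)=\mathbb{E}_{x}[d(\mu_R(x),D(x))]$ for uniform $x\sim\{0,1\}^n$. For $t=t(q)$ a function of $q$, $\mathcal{E}$ is $t$-efficient if for all $q$-query RDTs $R$ and DDTs $D$ of description lengths $N_R$ and $N_D$ respectively: (1) there is a deterministic $\mathrm{poly}(t,N_R,N_D)$-time algorithm that computes $\mathcal{E}(R,D)$; (2) there is a deterministic $\mathrm{poly}(t,N_R)$-time algorithm that computes the constant $c\in[0,1]$ minimizing $\mathcal{E}(R,c)$. -}

module Defs where

open import Level using (Level; _⊔_) renaming (suc to lsuc)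
open import Algebra.Bundles using (CommutativeRing; Semiring)
import Algebra.Definitions.RawSemiring as RawSemiringDefs
import Algebra.Properties.Ring as RingProperties
open import Algebra.Structures using (IsCommutativeRing)
open import Data.Bool.Base using (Bool; true; false)
open import Data.Empty using (⊥-elim)
open import Data.Fin.Base using (Fin; zero; suc; toℕ)
open import Data.Nat.Base as ℕ using (ℕ; zero; suc; s≤s)
import Data.Nat.Properties as ℕₚ
open import Data.Nat.Binary.Base as ℕᵇ using (ℕᵇ; 2[1+_]; 1+[2_])
open import Data.Product.Base using (∃; _×_)
open import Data.Sum.Base using (inj₁; inj₂)
open import Data.Vec.Base using (Vec; []; _∷_; lookup)
open import Function.Base using (_∘_)
import Relation.Binary.Construct.NonStrictToStrict as ToStrict
open import Relation.Binary.PropositionalEquality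
  using (_≡_; _≢_; refl; sym; trans; cong; cong₂; subst; subst₂; module ≡-Reasoning)
open import Relation.Binary.Structures using (IsDecTotalOrder)
open import Relation.Nullary using (¬_)
open import Relation.Nullary.Decidable.Core using (recompute)

-- The scalars are the elements of an arbitrary (decidably) ordered field.
-- The classical real numbers are one instance, ℚ is another.
-- The value of _⁻¹ at 0# is unspecified.

record OrderedField (a ℓ : Level) : Set (lsuc (a ⊔ ℓ)) where
  infix  8 -_
  infix  9 _⁻¹
  infixl 7 _*_
  infixl 6 _+_
  infix  4 _≤_
  field
    Carrier           : Set a
    _≤_               : Carrier → Carrier → Set ℓ
    _+_ _*_           : Carrier → Carrier → Carrier
    -_ _⁻¹            : Carrier → Carrier
    0# 1#             : Carrier
    isCommutativeRing : IsCommutativeRing _≡_ _+_ _*_ -_ 0# 1#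
    isDecTotalOrder   : IsDecTotalOrder _≡_ _≤_
    0≢1               : 0# ≢ 1#
    ⁻¹-inverse        : ∀ {x} → x ≢ 0# → x * x ⁻¹ ≡ 1#
    +-monoʳ-≤         : ∀ x {y z} → y ≤ z → x + y ≤ x + z
    *-nonNeg          : ∀ {x y} → 0# ≤ x → 0# ≤ y → 0# ≤ x * y

  commutativeRing : CommutativeRing a a
  commutativeRing = record { isCommutativeRing = isCommutativeRing }

  open CommutativeRing commutativeRing public
    using ( ring; semiring
          ; +-comm; +-assoc; +-identityˡ; +-identityʳ; -‿inverseˡ; -‿inverseʳ
          ; *-comm; *-assoc; *-identityˡ; *-identityʳ; distribˡ; distribʳ; zeroˡ; zeroʳ)
  open IsDecTotalOrder isDecTotalOrder public
    using (_≟_; _≤?_; total)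
    renaming (refl to ≤-refl; trans to ≤-trans; antisym to ≤-antisym; reflexive to ≤-reflexive)
  open ToStrict _≡_ _≤_ public using (_<_)
  open RawSemiringDefs (Semiring.rawSemiring semiring) public using (_^_)

  2# ½ : Carrier
  2# = 1# + 1#
  ½  = 2# ⁻¹

  private open RingProperties ring using (-‿distribʳ-*; -‿distribˡ-*; -‿involutive)

  +-mono-≤ : ∀ {w x y z} → w ≤ x → y ≤ z → w + y ≤ x + z
  +-mono-≤ {w} {x} {y} {z} w≤x y≤z =
    ≤-trans (+-monoʳ-≤ w y≤z) (subst₂ _≤_ (+-comm z w) (+-comm z x) (+-monoʳ-≤ z w≤x))

  neg-nonNeg : ∀ {x} → x ≤ 0# → 0# ≤ - x
  neg-nonNeg {x} x≤0 = subst₂ _≤_ (-‿inverseˡ x) (+-identityʳ (- x)) (+-monoʳ-≤ (- x) x≤0)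

  0≤1 : 0# ≤ 1#
  0≤1 with total 0# 1#
  ... | inj₁ 0≤1 = 0≤1
  ... | inj₂ 1≤0 = subst (0# ≤_) -1*-1≡1 (*-nonNeg 0≤-1 0≤-1)
    where
    0≤-1 = neg-nonNeg 1≤0
    -1*-1≡1 : - 1# * - 1# ≡ 1#
    -1*-1≡1 = trans (sym (-‿distribˡ-* 1# (- 1#)))
             (trans (cong -_ (*-identityˡ (- 1#))) (-‿involutive 1#))

  0≤2 : 0# ≤ 2#
  0≤2 = subst (_≤ 2#) (+-identityʳ 0#) (+-mono-≤ 0≤1 0≤1)

  2≢0 : 2# ≢ 0#
  2≢0 2≡0 = 0≢1 (≤-antisym 0≤1
    (subst₂ _≤_ (+-identityʳ 1#) 2≡0 (+-monoʳ-≤ 1# 0≤1)))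

  0≤½ : 0# ≤ ½
  0≤½ with total 0# ½
  ... | inj₁ 0≤½ = 0≤½
  ... | inj₂ ½≤0 = ⊥-elim (0≢1 (≤-antisym 0≤1 1≤0))
    where
    0≤-1 : 0# ≤ - 1#
    0≤-1 = subst (0# ≤_)
      (trans (sym (-‿distribʳ-* 2# ½)) (cong -_ (⁻¹-inverse 2≢0)))
      (*-nonNeg 0≤2 (neg-nonNeg ½≤0))
    1≤0 : 1# ≤ 0#
    1≤0 = subst₂ _≤_ (+-identityʳ 1#) (-‿inverseʳ 1#) (+-monoʳ-≤ 1# 0≤-1)

  *-monoʳ-≤ : ∀ {x y z} → 0# ≤ x → y ≤ z → x * y ≤ x * z
  *-monoʳ-≤ {x} {y} {z} 0≤x y≤z =
    subst₂ _≤_ (+-identityʳ (x * y)) sum≡ (+-monoʳ-≤ (x * y) (*-nonNeg 0≤x 0≤z-y))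
    where
    0≤z-y : 0# ≤ - y + z
    0≤z-y = subst (_≤ - y + z) (-‿inverseˡ y) (+-monoʳ-≤ (- y) y≤z)
    sum≡ : x * y + x * (- y + z) ≡ x * z
    sum≡ = trans (sym (distribˡ x y (- y + z)))
      (cong (x *_) (trans (sym (+-assoc y (- y) z))
        (trans (cong (_+ z) (-‿inverseʳ y)) (+-identityˡ z))))

  ½^-nonNeg : ∀ n → 0# ≤ ½ ^ n
  ½^-nonNeg zero    = 0≤1
  ½^-nonNeg (suc n) = *-nonNeg 0≤½ (½^-nonNeg n)

  ½^*2^ : ∀ n → ½ ^ n * 2# ^ n ≡ 1#
  ½^*2^ zero    = *-identityˡ 1#
  ½^*2^ (suc n) = begin
    (½ * h) * (2# * t)  ≡⟨ cong (_* (2# * t)) (*-comm ½ h) ⟩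
    (h * ½) * (2# * t)  ≡⟨ *-assoc h ½ (2# * t) ⟩
    h * (½ * (2# * t))  ≡⟨ cong (h *_) (sym (*-assoc ½ 2# t)) ⟩
    h * ((½ * 2#) * t)  ≡⟨ cong (λ u → h * (u * t)) (trans (*-comm ½ 2#) (⁻¹-inverse 2≢0)) ⟩
    h * (1# * t)        ≡⟨ cong (h *_) (*-identityˡ t) ⟩
    h * t               ≡⟨ ½^*2^ n ⟩
    1#                  ∎
    where
    open ≡-Reasoning
    h = ½ ^ n
    t = 2# ^ n

data Poly (k : ℕ) : Set where
  con     : ℕ → Poly k
  var     : Fin k → Poly k
  _⊕_ _⊗_ : Poly k → Poly k → Poly k

⟦_⟧ₚ : ∀ {k} → Poly k → Vec ℕ k → ℕ
⟦ con c ⟧ₚ ρ = c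
⟦ var i ⟧ₚ ρ = lookup ρ i
⟦ p ⊕ q ⟧ₚ ρ = ⟦ p ⟧ₚ ρ ℕ.+ ⟦ q ⟧ₚ ρ
⟦ p ⊗ q ⟧ₚ ρ = ⟦ p ⟧ₚ ρ ℕ.* ⟦ q ⟧ₚ ρ

-- Algorithms are closed terms of a call-by-value language whose data are
-- binary trees (LISP-style cons cells) with scalars as atoms.  Scalars are
-- handled as on a real RAM: exact field arithmetic and comparisons at unit
-- cost.  The only scalar constants are 0# and 1#, so a program is a finite
-- object that does not depend on the field.

data ArithOp : Set where
  add sub mul div : ArithOp

data Term (n : ℕ) : Set where
  var    : Fin n → Term n
  fun    : Term (suc (suc n)) → Term n
           -- recursive function; variable 0 is the argument and
           -- variable 1 is the function itself
  app    : Term n → Term n → Term n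
  nil    : Term n
  cons   : Term n → Term n → Term n
  case   : Term n → Term n → Term (suc (suc n)) → Term n
           -- nil branch, then cons branch, in which variable 0 is the
           -- head and variable 1 is the tail
  #0 #1  : Term n
  arith  : ArithOp → Term n → Term n → Term n
  leq    : Term n → Term n → Term n

Program : Set
Program = Term 0

module Over {a ℓ : Level} (F : OrderedField a ℓ) where

  open OrderedField F public using (0#; 1#; _≤_; _<_) renaming (Carrier to K)
  open OrderedField F hiding (Carrier; 0#; 1#; _≤_; _<_)

  -- The bounds are irrelevant so that equality of elements of [0,1] is
  -- equality of their values.

  record [0,1] : Set (a ⊔ ℓ) where
    constructor mk
    field
      value  : K
      .lower : 0# ≤ value
      .upper : value ≤ 1#
  open [0,1] public using (value)

  0≤value : ∀ u → 0# ≤ value u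
  0≤value (mk v l _) = recompute (0# ≤? v) l

  value≤1 : ∀ u → value u ≤ 1#
  value≤1 (mk v _ u) = recompute (v ≤? 1#) u

  Σ-cube : ∀ n → (Vec Bool n → K) → K
  Σ-cube zero    f = f []
  Σ-cube (suc n) f = Σ-cube n (f ∘ (false ∷_)) + Σ-cube n (f ∘ (true ∷_))

  Σ-cube-nonNeg : ∀ n {f} → (∀ x → 0# ≤ f x) → 0# ≤ Σ-cube n f
  Σ-cube-nonNeg zero    0≤f = 0≤f []
  Σ-cube-nonNeg (suc n) {f} 0≤f = subst (_≤ Σ-cube (suc n) f) (+-identityʳ 0#)
    (+-mono-≤ (Σ-cube-nonNeg n (0≤f ∘ (false ∷_))) (Σ-cube-nonNeg n (0≤f ∘ (true ∷_))))

  Σ-cube≤2^n : ∀ n {f} → (∀ x → f x ≤ 1#) → Σ-cube n f ≤ 2# ^ n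
  Σ-cube≤2^n zero    f≤1 = f≤1 []
  Σ-cube≤2^n (suc n) {f} f≤1 = subst (Σ-cube (suc n) f ≤_)
    (sym (trans (distribʳ t 1# 1#) (cong₂ _+_ (*-identityˡ t) (*-identityˡ t))))
    (+-mono-≤ (Σ-cube≤2^n n (f≤1 ∘ (false ∷_))) (Σ-cube≤2^n n (f≤1 ∘ (true ∷_))))
    where t = 2# ^ n

  𝔼 : ∀ n → (Vec Bool n → [0,1]) → [0,1]
  𝔼 n f = mk (½ ^ n * S)
    (*-nonNeg (½^-nonNeg n) (Σ-cube-nonNeg n (0≤value ∘ f)))
    (subst (½ ^ n * S ≤_) (½^*2^ n)
      (*-monoʳ-≤ (½^-nonNeg n) (Σ-cube≤2^n n (value≤1 ∘ f))))
    where S = Σ-cube n (value ∘ f)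

  data RDT (n : ℕ) : Set (a ⊔ ℓ) where
    leaf  : [0,1] → RDT n
    query : Fin n → RDT n → RDT n → RDT n
    coin  : RDT n → RDT n → RDT n

  queryComplexity : ∀ {n} → RDT n → ℕ
  queryComplexity (leaf _)      = 0
  queryComplexity (query _ S T) = suc (queryComplexity S ℕ.⊔ queryComplexity T)
  queryComplexity (coin S T)    = queryComplexity S ℕ.⊔ queryComplexity T

  randomness : ∀ {n} → RDT n → ℕ
  randomness (leaf _)      = 0
  randomness (query _ S T) = randomness S ℕ.⊔ randomness T
  randomness (coin S T)    = suc (randomness S ℕ.⊔ randomness T)

  eval : ∀ {n m} (T : RDT n) → Vec Bool n → Vec Bool m → randomness T ℕ.≤ m → [0,1]
  eval (leaf u)      x r le = u
  eval (query i S T) x r le with lookup x i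
  ... | false = eval S x r (ℕₚ.m⊔n≤o⇒m≤o (randomness S) (randomness T) le)
  ... | true  = eval T x r (ℕₚ.m⊔n≤o⇒n≤o (randomness S) (randomness T) le)
  eval (coin S T) x (false ∷ r) (s≤s le) =
    eval S x r (ℕₚ.m⊔n≤o⇒m≤o (randomness S) (randomness T) le)
  eval (coin S T) x (true ∷ r) (s≤s le) =
    eval T x r (ℕₚ.m⊔n≤o⇒n≤o (randomness S) (randomness T) le)

  μ : ∀ {n} → RDT n → Vec Bool n → [0,1]
  μ R x = 𝔼 (randomness R) (λ r → eval R x r ℕₚ.≤-refl)

  record DDT (n : ℕ) : Set (a ⊔ ℓ) where
    constructor ddt
    field
      tree          : RDT n
      deterministic : randomness tree ≡ 0
  open DDT public

  ⟦_⟧ : ∀ {n} → DDT n → Vec Bool n → [0,1]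
  ⟦ D ⟧ x = eval (tree D) x [] (ℕₚ.≤-reflexive (deterministic D))

  const : ∀ {n} → [0,1] → DDT n
  const c = ddt (leaf c) refl

  data Data : Set a where
    nil  : Data
    num  : K → Data
    cons : Data → Data → Data

  size : Data → ℕ
  size nil        = 1
  size (num _)    = 1
  size (cons d e) = suc (size d ℕ.+ size e)

  -- ℕᵇ is bijective binary notation, so the size is logarithmic.

  encodeℕᵇ : ℕᵇ → Data
  encodeℕᵇ ℕᵇ.zero  = nil
  encodeℕᵇ 1+[2 b ] = cons nil (encodeℕᵇ b)
  encodeℕᵇ 2[1+ b ] = cons (cons nil nil) (encodeℕᵇ b)

  encodeℕ : ℕ → Data
  encodeℕ = encodeℕᵇ ∘ ℕᵇ.fromℕ

  encodeTree : ∀ {n} → RDT n → Data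
  encodeTree (leaf u)      = cons nil (num (value u))
  encodeTree (query i S T) =
    cons (cons nil nil) (cons (encodeℕ (toℕ i)) (cons (encodeTree S) (encodeTree T)))
  encodeTree (coin S T)    =
    cons (cons nil (cons nil nil)) (cons (encodeTree S) (encodeTree T))

  describe : ∀ {n} → RDT n → Data
  describe {n} T = cons (encodeℕ n) (encodeTree T)

  descriptionLength : ∀ {n} → RDT n → ℕ
  descriptionLength T = size (describe T)

  data Value : Set a where
    nil     : Value
    num     : K → Value
    cons    : Value → Value → Value
    closure : ∀ {n} → Vec Value n → Term (suc (suc n)) → Value

  ⌜_⌝ : Data → Value
  ⌜ nil ⌝      = nil
  ⌜ num x ⌝    = num x
  ⌜ cons d e ⌝ = cons ⌜ d ⌝ ⌜ e ⌝

  data Arith : ArithOp → K → K → K → Set a where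
    add : ∀ {x y} → Arith add x y (x + y)
    sub : ∀ {x y} → Arith sub x y (x + - y)
    mul : ∀ {x y} → Arith mul x y (x * y)
    div : ∀ {x y} → y ≢ 0# → Arith div x y (x * y ⁻¹)

  -- ρ ⊢ e ⇓ v [ k ]: in environment ρ, e evaluates to v in k steps, a step
  -- being one application of an evaluation rule.
  -- f · u ⇓ v [ k ]: the function value f applied to u yields v in k steps.

  infix 4 _⊢_⇓_[_] _·_⇓_[_]

  mutual
    data _⊢_⇓_[_] {n} (ρ : Vec Value n) : Term n → Value → ℕ → Set (a ⊔ ℓ) where
      ⇓var  : ∀ {i} → ρ ⊢ var i ⇓ lookup ρ i [ 1 ]
      ⇓fun  : ∀ {e} → ρ ⊢ fun e ⇓ closure ρ e [ 1 ]
      ⇓app  : ∀ {e₁ e₂ f u v k₁ k₂ k₃} →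
              ρ ⊢ e₁ ⇓ f [ k₁ ] → ρ ⊢ e₂ ⇓ u [ k₂ ] → f · u ⇓ v [ k₃ ] →
              ρ ⊢ app e₁ e₂ ⇓ v [ suc (k₁ ℕ.+ k₂ ℕ.+ k₃) ]
      ⇓nil  : ρ ⊢ nil ⇓ nil [ 1 ]
      ⇓cons : ∀ {e₁ e₂ u v k₁ k₂} →
              ρ ⊢ e₁ ⇓ u [ k₁ ] → ρ ⊢ e₂ ⇓ v [ k₂ ] →
              ρ ⊢ cons e₁ e₂ ⇓ cons u v [ suc (k₁ ℕ.+ k₂) ]
      ⇓case-nil  : ∀ {e e₁ e₂ v k k₁} →
              ρ ⊢ e ⇓ nil [ k ] → ρ ⊢ e₁ ⇓ v [ k₁ ] →
              ρ ⊢ case e e₁ e₂ ⇓ v [ suc (k ℕ.+ k₁) ]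
      ⇓case-cons : ∀ {e e₁ e₂ h t v k k₂} →
              ρ ⊢ e ⇓ cons h t [ k ] → (h ∷ t ∷ ρ) ⊢ e₂ ⇓ v [ k₂ ] →
              ρ ⊢ case e e₁ e₂ ⇓ v [ suc (k ℕ.+ k₂) ]
      ⇓0    : ρ ⊢ #0 ⇓ num 0# [ 1 ]
      ⇓1    : ρ ⊢ #1 ⇓ num 1# [ 1 ]
      ⇓arith : ∀ {o e₁ e₂ x y z k₁ k₂} →
              ρ ⊢ e₁ ⇓ num x [ k₁ ] → ρ ⊢ e₂ ⇓ num y [ k₂ ] → Arith o x y z →
              ρ ⊢ arith o e₁ e₂ ⇓ num z [ suc (k₁ ℕ.+ k₂) ]
      ⇓leq-true  : ∀ {e₁ e₂ x y k₁ k₂} →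
              ρ ⊢ e₁ ⇓ num x [ k₁ ] → ρ ⊢ e₂ ⇓ num y [ k₂ ] → x ≤ y →
              ρ ⊢ leq e₁ e₂ ⇓ cons nil nil [ suc (k₁ ℕ.+ k₂) ]
      ⇓leq-false : ∀ {e₁ e₂ x y k₁ k₂} →
              ρ ⊢ e₁ ⇓ num x [ k₁ ] → ρ ⊢ e₂ ⇓ num y [ k₂ ] → ¬ x ≤ y →
              ρ ⊢ leq e₁ e₂ ⇓ nil [ suc (k₁ ℕ.+ k₂) ]

    data _·_⇓_[_] : Value → Value → Value → ℕ → Set (a ⊔ ℓ) where
      ·closure : ∀ {n} {ρ : Vec Value n} {e u v k} →
              (u ∷ closure ρ e ∷ ρ) ⊢ e ⇓ v [ k ] →
              closure ρ e · u ⇓ v [ suc k ]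

  record _on_returns_within_ (P : Program) (input output : Data) (time : ℕ) : Set (a ⊔ ℓ) where
    constructor run
    field
      {function}      : Value
      {load steps}    : ℕ
      loads           : [] ⊢ P ⇓ function [ load ]
      applies         : function · ⌜ input ⌝ ⇓ ⌜ output ⌝ [ steps ]
      withinTime      : load ℕ.+ steps ℕ.≤ time

  ErrorMetric : Set (a ⊔ ℓ)
  ErrorMetric = ∀ {n} → RDT n → DDT n → [0,1]

  Natural : ErrorMetric → Set (a ⊔ ℓ)
  Natural 𝓔 = ∃ λ (d : [0,1] → [0,1] → [0,1]) →
    ∀ {n} (R : RDT n) (D : DDT n) → 𝓔 R D ≡ 𝔼 n (λ x → d (μ R x) (⟦ D ⟧ x))

  Minimizes : ErrorMetric → ∀ {n} → RDT n → [0,1] → Set (a ⊔ ℓ)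
  Minimizes 𝓔 R c = ∀ c′ → value (𝓔 R (const c)) ≤ value (𝓔 R (const c′))

  ComputesError : ErrorMetric → (t : ℕ → ℕ) → Program → Poly 3 → Set (a ⊔ ℓ)
  ComputesError 𝓔 t P p = ∀ {n} q (R : RDT n) (D : DDT n) → queryComplexity R ℕ.≤ q →
    P on cons (describe R) (describe (tree D)) returns num (value (𝓔 R D))
      within ⟦ p ⟧ₚ (t q ∷ descriptionLength R ∷ descriptionLength (tree D) ∷ [])

  ComputesBestConstant : ErrorMetric → (t : ℕ → ℕ) → Program → Poly 2 → Set (a ⊔ ℓ)
  ComputesBestConstant 𝓔 t P p = ∀ {n} q (R : RDT n) → queryComplexity R ℕ.≤ q →
    ∃ λ c → Minimizes 𝓔 R c ×
      (P on describe R returns num (value c) within ⟦ p ⟧ₚ (t q ∷ descriptionLength R ∷ []))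

  Efficient : (ℕ → ℕ) → ErrorMetric → Set (a ⊔ ℓ)
  Efficient t 𝓔 =
    (∃ λ P → ∃ λ p → ComputesError 𝓔 t P p) ×
    (∃ λ P → ∃ λ p → ComputesBestConstant 𝓔 t P p)

  Achievable : ErrorMetric → ∀ {n} → RDT n → K → ℕ → Set (a ⊔ ℓ)
  Achievable 𝓔 {n} R ε q′ = ∃ λ (D : DDT n) →
    queryComplexity (tree D) ℕ.≤ q′ × value (𝓔 R D) ≤ ε

  IsOptimal : ErrorMetric → ∀ {n} → RDT n → K → ℕ → Set (a ⊔ ℓ)
  IsOptimal 𝓔 R ε q⋆ =
    Achievable 𝓔 R ε q⋆ × (∀ q′ → Achievable 𝓔 R ε q′ → q⋆ ℕ.≤ q′)

module Submission where

-- The algorithm computes, for k = 0, 1, 2, ..., a tree with at most k queries of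
-- least error, and stops at the first one whose error is at most ε.  Since each
-- of these trees is optimal for its k, this happens exactly at k = q⋆.
--
-- A best tree of depth k + 1 for R is the best constant or starts with a query
-- to some variable i, so the search is a recursion over i and over the two
-- restrictions of R to x i = 0 and to x i = 1.  This is sound because a natural
-- error is an average over x, and averages split along any coordinate
-- (average-split): twice the error of D is the sum of the errors of the
-- restrictions of D on the restrictions of R (error-restrict).  Using the
-- recursive results has one subtlety.  The tree D found for R restricted to
-- x i = b may itself query x i, whereas below a query to x i only its restriction
-- to x i = b matters.  But the restricted R ignores x i, so the error of D is the mean of
-- the errors of its two restrictions, neither of which is smaller, because D is
-- optimal; hence both are equal to it (optimal-restrict).  Therefore the error of
-- a query node over optimal subtrees is the mean of the two errors returned by
-- the recursive calls (error-optimal-query), and the given error program is run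
-- only on constant trees, which are not longer than R.
--
-- For the running time, let N be the description length of R.  The recursion for
-- depth k branches twice for each of the n variables, and everything else costs
-- at most Q for each branch, a polynomial in N and in the bounds of the two given
-- programs; the total is at most (3 (n + 1)) ^ k * Q (best-run).  The variables
-- are enumerated by a recursion on the binary numeral n that takes time O(n).
-- The search adds up q⋆ + 1 such bounds (search-run).  If n is at least 2, then
-- (3 (n + 1)) ^ q⋆ is at most a power of n ^ q⋆; if n is 0 or 1, then optimality
-- forces q⋆ to be at most n, and it is a constant (branching-bound).
--
-- The two given programs are known only through their runs, and each run loads
-- its program separately.  Evaluation is deterministic (⇓-functional), so all
-- runs of a program load the same function value, and the algorithm can bind it
-- once and call it many times.

open import Defs
open import Algebra.Bundles using (CommutativeRing)
import Algebra.Properties.CommutativeSemigroup as CommutativeSemigroupProperties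
open import Data.Bool.Base using (Bool; true; false; if_then_else_; T)
open import Data.Empty using (⊥-elim)
open import Data.Fin.Base using (Fin; zero; suc; toℕ; fromℕ; fromℕ<; _↑ˡ_)
import Data.Fin.Properties as Finₚ
open import Data.List.Base using (List; []; _∷_; _++_; length)
open import Data.List.Membership.Propositional using (_∈_)
open import Data.List.Relation.Unary.All as All using (All; []; _∷_)
open import Data.List.Relation.Unary.Any using (here; there)
open import Data.Nat.Base as ℕ using (ℕ; zero; suc; z≤n; s≤s)
open import Data.Nat.Binary.Base as ℕᵇ using (ℕᵇ; 2[1+_]; 1+[2_])
import Data.Nat.Binary.Properties as ℕᵇₚ
open import Data.Nat.ListAction using (sum)
open import Data.Nat.ListAction.Properties using (sum-++)
import Data.Nat.Properties as ℕₚ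
open import Data.Nat.Tactic.RingSolver using (solve-∀)
open import Data.Product using (∃; _×_; _,_; proj₁; proj₂)
open import Data.Sum.Base using (inj₁; inj₂)
open import Data.Vec.Base as Vec using (Vec; []; _∷_; lookup; _[_]≔_)
open import Data.Vec.Properties using (lookup∘update; lookup∘update′; []≔-idempotent; lookup-map)
open import Data.Vec.Relation.Binary.Pointwise.Inductive as Pointwise using (Pointwise; []; _∷_)
open import Function.Base using (_∘_)
open import Function.Bundles using (mk⇔)
open import Level using () renaming (_⊔_ to _⊔ˡ_)
open import Relation.Binary.PropositionalEquality
  using (_≡_; refl; sym; trans; cong; cong₂; subst; subst₂; module ≡-Reasoning)
open import Relation.Nullary using (Dec; yes; no; does; ¬_)
open import Relation.Nullary.Decidable using (does-⇔)

-- Polynomial bounds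

module Polynomials where
  open import Data.Nat.Base using (_+_; _*_; _^_; _≤_)
  open ℕₚ

  substitute : ∀ {k l} → Poly k → Vec (Poly l) k → Poly l
  substitute (con c) σ = con c
  substitute (var i) σ = lookup σ i
  substitute (p ⊕ q) σ = substitute p σ ⊕ substitute q σ
  substitute (p ⊗ q) σ = substitute p σ ⊗ substitute q σ

  ⟦substitute⟧ : ∀ {k l} (p : Poly k) (σ : Vec (Poly l) k) ρ →
    ⟦ substitute p σ ⟧ₚ ρ ≡ ⟦ p ⟧ₚ (Vec.map (λ r → ⟦ r ⟧ₚ ρ) σ)
  ⟦substitute⟧ (con c) σ ρ = refl
  ⟦substitute⟧ (var i) σ ρ = sym (lookup-map i (λ r → ⟦ r ⟧ₚ ρ) σ)
  ⟦substitute⟧ (p ⊕ q) σ ρ = cong₂ _+_ (⟦substitute⟧ p σ ρ) (⟦substitute⟧ q σ ρ)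
  ⟦substitute⟧ (p ⊗ q) σ ρ = cong₂ _*_ (⟦substitute⟧ p σ ρ) (⟦substitute⟧ q σ ρ)

  ⟦⟧ₚ-mono : ∀ {k} (p : Poly k) {ρ ρ′} → Pointwise _≤_ ρ ρ′ → ⟦ p ⟧ₚ ρ ≤ ⟦ p ⟧ₚ ρ′
  ⟦⟧ₚ-mono (con c) ρ≤ρ′ = ≤-refl
  ⟦⟧ₚ-mono (var i) ρ≤ρ′ = Pointwise.lookup ρ≤ρ′ i
  ⟦⟧ₚ-mono (p ⊕ q) ρ≤ρ′ = +-mono-≤ (⟦⟧ₚ-mono p ρ≤ρ′) (⟦⟧ₚ-mono q ρ≤ρ′)
  ⟦⟧ₚ-mono (p ⊗ q) ρ≤ρ′ = *-mono-≤ (⟦⟧ₚ-mono p ρ≤ρ′) (⟦⟧ₚ-mono q ρ≤ρ′)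

  1+n≤2^n : ∀ n → suc n ≤ 2 ^ n
  1+n≤2^n zero    = ≤-refl
  1+n≤2^n (suc n) = +-mono-≤ (m^n>0 2 n) (≤-trans (1+n≤2^n n) (≤-reflexive (sym (+-identityʳ (2 ^ n)))))

  -- For n at least 2, the base 3 (n + 1) is at most n ^ 4.  For n = 0 and n = 1 the
  -- powers n ^ q do not grow, and the hypotheses bound q instead.
  branching-bound : ∀ n q → (n ≡ 0 → q ≡ 0) → (n ≡ 1 → q ≤ 1) → (3 * suc n) ^ q ≤ 6 * (n ^ q) ^ 4
  branching-bound 0 q q≡0 _ rewrite q≡0 refl = s≤s z≤n
  branching-bound 1 q _ q≤1 = begin
    6 ^ q            ≤⟨ ^-monoʳ-≤ 6 (q≤1 refl) ⟩
    6                ≡⟨ cong (λ y → 6 * y ^ 4) (^-zeroˡ q) ⟨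
    6 * (1 ^ q) ^ 4  ∎
    where open ≤-Reasoning
  branching-bound n@(suc (suc m)) q _ _ = begin
    (3 * suc n) ^ q  ≤⟨ ^-monoˡ-≤ q (≤-trans (m≤m+n _ _) (≤-reflexive (expand m))) ⟩
    (n ^ 4) ^ q      ≡⟨ ^-*-assoc n 4 q ⟩
    n ^ (4 * q)      ≡⟨ cong (n ^_) (*-comm 4 q) ⟩
    n ^ (q * 4)      ≡⟨ ^-*-assoc n q 4 ⟨
    (n ^ q) ^ 4      ≤⟨ m≤n*m ((n ^ q) ^ 4) 6 ⟩
    6 * (n ^ q) ^ 4  ∎
    where
    open ≤-Reasoning
    -- The difference of the two sides of 3 (n + 1) ≤ n ^ 4 at n = m + 2, expanded;
    -- all its coefficients are nonnegative.
    expand : ∀ m → 3 * (3 + m) + (7 + 29 * m + 24 * (m * m) + 8 * (m * (m * m)) + m * (m * (m * m)))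
      ≡ (2 + m) * ((2 + m) * ((2 + m) * ((2 + m) * 1)))
    expand = solve-∀

  -- E and C bound the calls of the two given programs, X is the bound of
  -- branching-bound at Y = n ^ q⋆, and Q is the cost of one branch of the recursion.
  runningTime : Poly 3 → Poly 2 → Poly 3
  runningTime pᵉ pᶜ = con 60 ⊕ (E ⊕ (C ⊕ (X ⊗ (con 50 ⊕ (X ⊗ Q)))))
    where
    N tq Y E C X Q : Poly 3
    N = var zero
    tq = var (suc zero)
    Y = var (suc (suc zero))
    E = substitute pᵉ (tq ∷ N ∷ N ∷ [])
    C = substitute pᶜ (tq ∷ N ∷ [])
    X = con 6 ⊗ (Y ⊗ (Y ⊗ (Y ⊗ (Y ⊗ con 1))))
    Q = con 400 ⊕ ((N ⊗ con 100) ⊕ ((N ⊗ con 100) ⊕ (C ⊕ E)))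

open Polynomials

-- The algorithm

module Programs where
  open import Data.Nat.Base using (_+_)

  -- Terms without free variables are given in every context, in place of
  -- weakening.  Contexts are described from variable 0 upwards, an underscore
  -- standing for a variable that is not referred to.

  ix : ∀ k {n} → Fin (suc k + n)
  ix k = fromℕ k ↑ˡ _

  v : ∀ k {n} → Term (suc k + n)
  v k = var (ix k)

  -- A case on a cell binds a value without a closure; variable 1 is then nil.
  letin : ∀ {n} → Term n → Term (2 + n) → Term n
  letin e e′ = case (cons e nil) nil e′

  trueT falseT : ∀ {n} → Term n
  trueT  = cons nil nil
  falseT = nil

  -- Context: y, eq x, x, eq.  The digits are stored from the least significant.
  equalBody : ∀ {n} → Term (4 + n)
  equalBody =
    case (v 2) (case (v 0) trueT falseT)
      (case (v 2) falseT
        -- Context: first digit and rest of y, first digit and rest of x, y, eq x, x, eq.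
        (case (v 2) (case (v 0) (app (app (v 7) (v 3)) (v 1)) falseT)
                 (case (v 2) falseT (app (app (v 11) (v 7)) (v 5)))))

  equalT : ∀ {n} → Term n
  equalT = fun (fun equalBody)

  -- Context: tree, restrict i b, b, _, i, _.  The tag of a tree is nil for a
  -- leaf, and its second component is nil for a query and a cons for a coin.
  restrictBody : ∀ {n} → Term (6 + n)
  restrictBody =
    case (v 0) nil
      (case (v 0) (v 2)
        (case (v 1)
          (case (v 3) nil (case (v 1) nil
            -- Context: S, T, j, _, _, _, tag, _, _, restrict i b, b, _, i.
            (case (app (app equalT (v 12)) (v 2))
              (cons (v 6) (cons (v 2) (cons (app (v 9) (v 0)) (app (v 9) (v 1)))))
              (case (v 12) (app (v 11) (v 2)) (app (v 13) (v 5))))))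
          -- Context after the split: S, T, _, _, _, _, tag, _, _, restrict i b.
          (case (v 5) nil (cons (v 6) (cons (app (v 9) (v 0)) (app (v 9) (v 1)))))))

  restrictT : ∀ {n} → Term n
  restrictT = fun (fun (fun restrictBody))

  childrenBody : ∀ {n} → Term (2 + n)
  childrenBody =
    case (v 0) nil (cons (cons nil (v 0)) (cons (cons trueT (v 0)) (app (v 3) (v 1))))

  childrenT : ∀ {n} → Term n
  childrenT = fun childrenBody

  belowBody : ∀ {n} → Term (2 + n)
  belowBody =
    case (v 0) nil
      (letin (cons nil (app childrenT (app (v 3) (v 1))))
        (case (v 2) (v 0) (cons (cons nil (v 5)) (v 2))))

  belowT : ∀ {n} → Term n
  belowT = fun belowBody

  -- The pair of the least error of a constant and of the leaf with that constant.
  -- The variables move by 2 under the binding of the leaf.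
  leafT : ∀ {n} → (tree size bestConstant error : Fin n) → Term n
  leafT t s c e =
    letin (cons nil (app (var c) (cons (var s) (var t))))
      (cons (app (var (suc (suc e)))
              (cons (cons (var (suc (suc s))) (var (suc (suc t)))) (cons (var (suc (suc s))) (v 0))))
            (v 0))

  halfT : ∀ {n} → Term n → Term n → Term n
  halfT e e′ = arith div (arith add e e′) (arith add #1 #1)

  queryT : ∀ {n} → Term n → Term n → Term n → Term n
  queryT i e e′ = cons trueT (cons i (cons e e′))

  -- Context: e, _, e₁, D₁, e₀, D₀, e′, D′, i, where e′ and D′ are the error
  -- and the tree of the best candidate among the further indices.
  keepBetter : ∀ {n} → Term (10 + n)
  keepBetter =
    case (leq (v 6) (v 0))
      (cons (v 0) (queryT (v 8) (v 5) (v 3)))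
      (cons (v 8) (v 9))

  -- The loop over the variables to query first.  Context: remaining indices,
  -- loop, _, k, R, _, _, best, n, _, _, _, _, _, constant program, _,
  -- error program, _.
  loopBody : ∀ {n} → Term (18 + n)
  loopBody =
    case (v 0)
      (leafT (ix 4) (ix 8) (ix 14) (ix 16))
      -- New: i, further indices.
      (case (app (v 3) (v 1)) nil
      -- New: error and tree of the best candidate among the further indices.
      (case (app (app (v 11) (v 7)) (app (app (app restrictT (v 2)) falseT) (v 8))) nil
      -- New: error and tree for the restriction to x i = 0.
      (case (app (app (v 13) (v 9)) (app (app (app restrictT (v 4)) trueT) (v 10))) nil
      -- New: error and tree for the restriction to x i = 1.
      (letin (halfT (v 2) (v 0))
      keepBetter))))

  -- A pair of the least error and a tree attaining it.  Context: R, _, k, best,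
  -- n, _, _, _, _, _, constant program, _, error program, _.  The counter k is
  -- a list of that length.
  bestBody : ∀ {n} → Term (14 + n)
  bestBody =
    case (v 2)
      (leafT (ix 0) (ix 4) (ix 10) (ix 12))
      (app (fun loopBody) (app belowT (v 6)))

  -- Context: k, search, best, _, n, R, _, ε.
  searchBody : ∀ {n} → Term (8 + n)
  searchBody =
    case (app (app (v 2) (v 0)) (v 5)) nil
      (case (leq (v 0) (v 9))
        (app (v 3) (cons nil (v 2)))
        (cons (v 8) (v 3)))

  -- Context: input, _, constant program, _, error program, _.
  mainBody : Term 6
  mainBody =
    case (v 0) nil (case (v 0) nil
      (letin (fun (fun bestBody)) (app (fun searchBody) nil)))

  instanceOpt : Program → Program → Program
  instanceOpt Pᵉ Pᶜ = app (app (fun (fun (fun mainBody))) Pᵉ) Pᶜ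

open Programs

-- Enumeration of the variables in binary

module Variables where
  open import Data.Nat.Base using (_+_; _*_)
  open ℕₚ

  children : List ℕᵇ → List ℕᵇ
  children []       = []
  children (j ∷ js) = 1+[2 j ] ∷ 2[1+ j ] ∷ children js

  -- The numbers below 2 m + 1 are 0 and the 2 j + 1 and 2 j + 2 for j < m; those
  -- below 2 m + 2 include 2 m + 1 in addition.  Unlike counting up to n, this needs
  -- neither a successor nor a comparison of numerals.
  below : ℕᵇ → List ℕᵇ
  below ℕᵇ.zero  = []
  below 1+[2 n ] = ℕᵇ.zero ∷ children (below n)
  below 2[1+ n ] = 1+[2 n ] ∷ ℕᵇ.zero ∷ children (below n)

  odd∈children : ∀ {j js} → j ∈ js → 1+[2 j ] ∈ children js
  odd∈children (here refl) = here refl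
  odd∈children (there j∈)  = there (there (odd∈children j∈))

  even∈children : ∀ {j js} → j ∈ js → 2[1+ j ] ∈ children js
  even∈children (here refl) = there (here refl)
  even∈children (there j∈)  = there (there (even∈children j∈))

  <⇒∈below : ∀ {j n} → j ℕᵇ.< n → j ∈ below n
  <⇒∈below ℕᵇ.0<even               = there (here refl)
  <⇒∈below ℕᵇ.0<odd                = here refl
  <⇒∈below (ℕᵇ.even<even j<n)      = there (there (even∈children (<⇒∈below j<n)))
  <⇒∈below (ℕᵇ.even<odd j<n)       = there (even∈children (<⇒∈below j<n))
  <⇒∈below (ℕᵇ.odd<even (inj₁ j<n)) = there (there (odd∈children (<⇒∈below j<n)))
  <⇒∈below (ℕᵇ.odd<even (inj₂ refl)) = here refl
  <⇒∈below (ℕᵇ.odd<odd j<n)        = there (odd∈children (<⇒∈below j<n))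

  children-All : ∀ {P Q : ℕᵇ → Set} → (∀ {j} → P j → Q 1+[2 j ] × Q 2[1+ j ]) →
    ∀ {js} → All P js → All Q (children js)
  children-All f []         = []
  children-All f (pj ∷ pjs) = proj₁ (f pj) ∷ proj₂ (f pj) ∷ children-All f pjs

  below-< : ∀ n → All (ℕᵇ._< n) (below n)
  below-< ℕᵇ.zero  = []
  below-< 1+[2 n ] = ℕᵇ.0<odd ∷ children-All (λ j<n → ℕᵇ.odd<odd j<n , ℕᵇ.even<odd j<n) (below-< n)
  below-< 2[1+ n ] = ℕᵇ.odd<even (inj₂ refl) ∷ ℕᵇ.0<even ∷
    children-All (λ j<n → ℕᵇ.odd<even (inj₁ j<n) , ℕᵇ.even<even j<n) (below-< n)

  length-children : ∀ js → length (children js) ≡ 2 * length js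
  length-children []       = refl
  length-children (j ∷ js) =
    trans (cong (2 +_) (length-children js)) (sym (*-suc 2 (length js)))

  length-below : ∀ n → length (below n) ≡ ℕᵇ.toℕ n
  length-below ℕᵇ.zero  = refl
  length-below 1+[2 n ] = cong suc (trans (length-children (below n)) (cong (2 *_) (length-below n)))
  length-below 2[1+ n ] = trans (cong (2 +_) (trans (length-children (below n)) (cong (2 *_) (length-below n))))
    (sym (*-suc 2 (ℕᵇ.toℕ n)))

  fromℕ-toℕ-< : ∀ {n} (i : Fin n) → ℕᵇ.fromℕ (toℕ i) ∈ below (ℕᵇ.fromℕ n)
  fromℕ-toℕ-< i = <⇒∈below (ℕᵇₚ.fromℕ-mono-< (Finₚ.toℕ<n i))

  Represents : ∀ {n} → ℕᵇ → Fin n → Set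
  Represents b i = b ≡ ℕᵇ.fromℕ (toℕ i)

  below-represents : ∀ n → All (λ b → ∃ λ (i : Fin n) → Represents b i) (below (ℕᵇ.fromℕ n))
  below-represents n = All.map represents (below-< (ℕᵇ.fromℕ n))
    where
    represents : ∀ {b} → b ℕᵇ.< ℕᵇ.fromℕ n → ∃ λ (i : Fin n) → Represents b i
    represents {b} b<n = fromℕ< b<n′ ,
      trans (sym (ℕᵇₚ.fromℕ-toℕ b)) (cong ℕᵇ.fromℕ (sym (Finₚ.toℕ-fromℕ< b<n′)))
      where
      b<n′ : ℕᵇ.toℕ b ℕ.< n
      b<n′ = subst (ℕᵇ.toℕ b ℕ.<_) (ℕᵇₚ.toℕ-fromℕ n) (ℕᵇₚ.toℕ-mono-< b<n)

open Variables

-- Natural error metrics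

module Metric {a ℓ} (F : OrderedField a ℓ) where
  open Over F
  open OrderedField F hiding (Carrier; 0#; 1#; _≤_; _<_)
  open CommutativeSemigroupProperties
    (CommutativeRing.+-commutativeSemigroup commutativeRing) using (interchange)
  open ≡-Reasoning

  ½*2≡1 : ½ * 2# ≡ 1#
  ½*2≡1 = trans (*-comm ½ 2#) (⁻¹-inverse 2≢0)

  double : ∀ x → x + x ≡ 2# * x
  double x = sym (trans (distribʳ x 1# 1#) (cong₂ _+_ (*-identityˡ x) (*-identityˡ x)))

  ½*double : ∀ x → ½ * (x + x) ≡ x
  ½*double x = begin
    ½ * (x + x)   ≡⟨ cong (½ *_) (double x) ⟩
    ½ * (2# * x)  ≡⟨ *-assoc ½ 2# x ⟨
    ½ * 2# * x    ≡⟨ cong (_* x) ½*2≡1 ⟩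
    1# * x        ≡⟨ *-identityˡ x ⟩
    x             ∎

  ½+½ : ∀ x → ½ * x + ½ * x ≡ x
  ½+½ x = trans (sym (distribˡ ½ x x)) (½*double x)

  +-cancelˡ-≤ : ∀ x {y z} → x + y ≤ x + z → y ≤ z
  +-cancelˡ-≤ x {y} {z} le = subst₂ _≤_ (undo y) (undo z) (+-monoʳ-≤ (- x) le)
    where
    undo : ∀ w → - x + (x + w) ≡ w
    undo w = trans (sym (+-assoc (- x) x w)) (trans (cong (_+ w) (-‿inverseˡ x)) (+-identityˡ w))

  -- If y were larger than the mean x of y and z, then z would be smaller than x.
  mean-lower-bound : ∀ {x y z} → x + x ≡ y + z → x ≤ y → x ≤ z → y ≡ x
  mean-lower-bound {x} {y} {z} eq x≤y x≤z = ≤-antisym y≤x x≤y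
    where
    y≤x : y ≤ x
    y≤x = +-cancelˡ-≤ x (subst (x + y ≤_) (sym (trans eq (+-comm y z))) (+-mono-≤ x≤z ≤-refl))

  value-injective : ∀ {u v : [0,1]} → value u ≡ value v → u ≡ v
  value-injective {mk _ _ _} {mk _ _ _} refl = refl

  -- The value of 𝔼, for functions with arbitrary values in the field.
  average : ∀ n → (Vec Bool n → K) → K
  average n f = ½ ^ n * Σ-cube n f

  Σ-cube-cong : ∀ n {f g} → (∀ x → f x ≡ g x) → Σ-cube n f ≡ Σ-cube n g
  Σ-cube-cong zero    f≗g = f≗g []
  Σ-cube-cong (suc n) f≗g =
    cong₂ _+_ (Σ-cube-cong n (f≗g ∘ (false ∷_))) (Σ-cube-cong n (f≗g ∘ (true ∷_)))

  average-cong : ∀ n {f g} → (∀ x → f x ≡ g x) → average n f ≡ average n g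
  average-cong n f≗g = cong (½ ^ n *_) (Σ-cube-cong n f≗g)

  average-suc : ∀ n f →
    average (suc n) f ≡ ½ * (average n (f ∘ (false ∷_)) + average n (f ∘ (true ∷_)))
  average-suc n f = trans (*-assoc ½ (½ ^ n) _) (cong (½ *_) (distribˡ (½ ^ n) _ _))

  average-const : ∀ n c → average n (λ _ → c) ≡ c
  average-const zero    c = *-identityˡ c
  average-const (suc n) c =
    trans (average-suc n (λ _ → c))
      (trans (cong (λ u → ½ * (u + u)) (average-const n c)) (½*double c))

  -- Fixing coordinate i either way and averaging the two results loses nothing.
  -- The equation is doubled to keep ½ out of it.
  average-split : ∀ n (i : Fin n) f → average n f + average n f ≡
    average n (λ x → f (x [ i ]≔ false)) + average n (λ x → f (x [ i ]≔ true))
  average-split (suc n) zero f = begin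
    average (suc n) f + average (suc n) f  ≡⟨ cong₂ _+_ (average-suc n f) (average-suc n f) ⟩
    ½ * (A + B) + ½ * (A + B)              ≡⟨ ½+½ (A + B) ⟩
    A + B                                  ≡⟨ cong₂ _+_ (constant false) (constant true) ⟨
    average (suc n) (λ x → f (x [ zero ]≔ false))
      + average (suc n) (λ x → f (x [ zero ]≔ true)) ∎
    where
    A = average n (f ∘ (false ∷_))
    B = average n (f ∘ (true ∷_))
    constant : ∀ b → average (suc n) (λ x → f (x [ zero ]≔ b)) ≡ average n (f ∘ (b ∷_))
    constant b = trans (average-suc n (λ x → f (x [ zero ]≔ b))) (½*double _)
  average-split (suc n) (suc i) f = begin
    average (suc n) f + average (suc n) f  ≡⟨ cong₂ _+_ (average-suc n f) (average-suc n f) ⟩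
    ½ * (A + B) + ½ * (A + B)              ≡⟨ distribˡ ½ (A + B) (A + B) ⟨
    ½ * ((A + B) + (A + B))                ≡⟨ cong (½ *_) (interchange A B A B) ⟩
    ½ * ((A + A) + (B + B))                ≡⟨ cong (½ *_) (cong₂ _+_
                                                (average-split n i (f ∘ (false ∷_)))
                                                (average-split n i (f ∘ (true ∷_)))) ⟩
    ½ * ((A₀ + A₁) + (B₀ + B₁))            ≡⟨ cong (½ *_) (interchange A₀ A₁ B₀ B₁) ⟩
    ½ * ((A₀ + B₀) + (A₁ + B₁))            ≡⟨ distribˡ ½ (A₀ + B₀) (A₁ + B₁) ⟩
    ½ * (A₀ + B₀) + ½ * (A₁ + B₁)          ≡⟨ cong₂ _+_
                                                (average-suc n (λ x → f (x [ suc i ]≔ false)))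
                                                (average-suc n (λ x → f (x [ suc i ]≔ true))) ⟨
    average (suc n) (λ x → f (x [ suc i ]≔ false))
      + average (suc n) (λ x → f (x [ suc i ]≔ true)) ∎
    where
    A  = average n (f ∘ (false ∷_))
    B  = average n (f ∘ (true ∷_))
    A₀ = average n (λ x → f (false ∷ (x [ i ]≔ false)))
    A₁ = average n (λ x → f (false ∷ (x [ i ]≔ true)))
    B₀ = average n (λ x → f (true ∷ (x [ i ]≔ false)))
    B₁ = average n (λ x → f (true ∷ (x [ i ]≔ true)))

  -- The mean function by recursion on the tree: fair coins need not share a random
  -- string of fixed length.
  mean : ∀ {n} → RDT n → Vec Bool n → K
  mean (leaf u)      x = value u
  mean (query i S T) x = if lookup x i then mean T x else mean S x
  mean (coin S T)    x = ½ * (mean S x + mean T x)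

  -- Stated for every sufficient length m, because the subtrees of a node are run on
  -- random strings that may be longer than they need.
  average-eval : ∀ {n} (R : RDT n) x m (le : randomness R ℕ.≤ m) →
    average m (λ r → value (eval R x r le)) ≡ mean R x
  average-eval (leaf u) x m le = average-const m (value u)
  average-eval (query i S T) x m le with lookup x i
  ... | false = average-eval S x m _
  ... | true  = average-eval T x m _
  average-eval (coin S T) x (suc m) (s≤s le) =
    trans (average-suc m (λ r → value (eval (coin S T) x r (s≤s le))))
      (cong (½ *_) (cong₂ _+_ (average-eval S x m _) (average-eval T x m _)))

  value-μ : ∀ {n} (R : RDT n) x → value (μ R x) ≡ mean R x
  value-μ R x = average-eval R x (randomness R) ℕₚ.≤-refl

  -- A deterministic tree is its own mean: the average over the empty string.
  value-⟦⟧ : ∀ {n} (D : DDT n) x → value (⟦ D ⟧ x) ≡ mean (tree D) x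
  value-⟦⟧ D x = trans (sym (*-identityˡ _)) (average-eval (tree D) x 0 _)

  -- All queries to i are removed, also below the first, so that the result
  -- ignores x i.
  restrict : ∀ {n} → Fin n → Bool → RDT n → RDT n
  restrict i b (leaf u)      = leaf u
  restrict i b (query j S T) =
    if does (i Finₚ.≟ j)
    then (if b then restrict i b T else restrict i b S)
    else query j (restrict i b S) (restrict i b T)
  restrict i b (coin S T)    = coin (restrict i b S) (restrict i b T)

  restrict-query : ∀ {n} (i : Fin n) b (S T : RDT n) →
    restrict i b (query i S T) ≡ (if b then restrict i b T else restrict i b S)
  restrict-query i b S T with i Finₚ.≟ i
  ... | yes _  = refl
  ... | no i≢i = ⊥-elim (i≢i refl)

  mean-restrict : ∀ {n} i b (R : RDT n) x → mean (restrict i b R) x ≡ mean R (x [ i ]≔ b)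
  mean-restrict i b (leaf u) x = refl
  mean-restrict i b (query j S T) x with i Finₚ.≟ j
  mean-restrict i false (query i S T) x | yes refl rewrite lookup∘update i x false = mean-restrict i false S x
  mean-restrict i true  (query i S T) x | yes refl rewrite lookup∘update i x true  = mean-restrict i true T x
  mean-restrict i b (query j S T) x | no i≢j
    rewrite lookup∘update′ (i≢j ∘ sym) x b | mean-restrict i b S x | mean-restrict i b T x = refl
  mean-restrict i b (coin S T) x =
    cong (½ *_) (cong₂ _+_ (mean-restrict i b S x) (mean-restrict i b T x))

  queryComplexity-restrict : ∀ {n} i b (R : RDT n) →
    queryComplexity (restrict i b R) ℕ.≤ queryComplexity R
  queryComplexity-restrict i b (leaf u) = z≤n
  queryComplexity-restrict i b (query j S T) with does (i Finₚ.≟ j)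
  ... | false = s≤s (ℕₚ.⊔-mono-≤ (queryComplexity-restrict i b S) (queryComplexity-restrict i b T))
  queryComplexity-restrict i false (query j S T) | true =
    ℕₚ.≤-trans (queryComplexity-restrict i false S) (ℕₚ.m≤n⇒m≤1+n (ℕₚ.m≤m⊔n _ _))
  queryComplexity-restrict i true  (query j S T) | true =
    ℕₚ.≤-trans (queryComplexity-restrict i true T) (ℕₚ.m≤n⇒m≤1+n (ℕₚ.m≤n⊔m _ _))
  queryComplexity-restrict i b (coin S T) =
    ℕₚ.⊔-mono-≤ (queryComplexity-restrict i b S) (queryComplexity-restrict i b T)

  randomness-restrict : ∀ {n} i b (R : RDT n) → randomness (restrict i b R) ℕ.≤ randomness R
  randomness-restrict i b (leaf u) = z≤n
  randomness-restrict i b (query j S T) with does (i Finₚ.≟ j)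
  ... | false = ℕₚ.⊔-mono-≤ (randomness-restrict i b S) (randomness-restrict i b T)
  randomness-restrict i false (query j S T) | true =
    ℕₚ.≤-trans (randomness-restrict i false S) (ℕₚ.m≤m⊔n _ _)
  randomness-restrict i true  (query j S T) | true =
    ℕₚ.≤-trans (randomness-restrict i true T) (ℕₚ.m≤n⊔m _ _)
  randomness-restrict i b (coin S T) =
    s≤s (ℕₚ.⊔-mono-≤ (randomness-restrict i b S) (randomness-restrict i b T))

  restrictᴰ : ∀ {n} → Fin n → Bool → DDT n → DDT n
  restrictᴰ i b (ddt T det) = ddt (restrict i b T)
    (ℕₚ.n≤0⇒n≡0 (subst (randomness (restrict i b T) ℕ.≤_) det (randomness-restrict i b T)))

  queryᴰ : ∀ {n} → Fin n → DDT n → DDT n → DDT n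
  queryᴰ i (ddt S detS) (ddt T detT) = ddt (query i S T) (cong₂ ℕ._⊔_ detS detT)

  module NaturalMetric (𝓔 : ErrorMetric) (natural : Natural 𝓔) where

    error : ∀ {n} → RDT n → DDT n → K
    error R D = value (𝓔 R D)

    d = proj₁ natural

    error≡average : ∀ {n} (R : RDT n) (D : DDT n) →
      error R D ≡ average n (λ x → value (d (μ R x) (⟦ D ⟧ x)))
    error≡average R D = cong value (proj₂ natural R D)

    -- The mean functions determine the arguments of d because elements of [0,1] with
    -- the same value are equal.
    d-cong : ∀ {n} {R R′ : RDT n} {D D′ : DDT n} {x x′} →
      mean R x ≡ mean R′ x′ → mean (tree D) x ≡ mean (tree D′) x′ →
      value (d (μ R x) (⟦ D ⟧ x)) ≡ value (d (μ R′ x′) (⟦ D′ ⟧ x′))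
    d-cong {R = R} {R′} {D} {D′} {x} {x′} p q = cong₂ (λ u v → value (d u v))
      (value-injective (trans (value-μ R x) (trans p (sym (value-μ R′ x′)))))
      (value-injective (trans (value-⟦⟧ D x) (trans q (sym (value-⟦⟧ D′ x′)))))

    error-cong : ∀ {n} {R R′ : RDT n} {D D′ : DDT n} →
      (∀ x → mean R x ≡ mean R′ x) → (∀ x → mean (tree D) x ≡ mean (tree D′) x) →
      error R D ≡ error R′ D′
    error-cong {n} {R} {R′} {D} {D′} p q =
      trans (error≡average R D)
        (trans (average-cong n (λ x → d-cong {R = R} {R′} {D} {D′} (p x) (q x)))
          (sym (error≡average R′ D′)))

    error-restrict : ∀ {n} (i : Fin n) (R : RDT n) (D : DDT n) →
      error R D + error R D ≡
      error (restrict i false R) (restrictᴰ i false D) + error (restrict i true R) (restrictᴰ i true D)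
    error-restrict {n} i R D = begin
      error R D + error R D    ≡⟨ cong₂ _+_ (error≡average R D) (error≡average R D) ⟩
      average n f + average n f ≡⟨ average-split n i f ⟩
      average n (λ x → f (x [ i ]≔ false)) + average n (λ x → f (x [ i ]≔ true))
                                ≡⟨ cong₂ _+_ (branch false) (branch true) ⟨
      error (restrict i false R) (restrictᴰ i false D) + error (restrict i true R) (restrictᴰ i true D) ∎
      where
      f : Vec Bool n → K
      f x = value (d (μ R x) (⟦ D ⟧ x))
      branch : ∀ b → error (restrict i b R) (restrictᴰ i b D) ≡ average n (λ x → f (x [ i ]≔ b))
      branch b = trans (error≡average (restrict i b R) (restrictᴰ i b D))
        (average-cong n (λ x → d-cong {R = restrict i b R} {R} {restrictᴰ i b D} {D}
          (mean-restrict i b R x) (mean-restrict i b (tree D) x)))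

    error-restrict-query : ∀ {n} (i : Fin n) (R : RDT n) (D₀ D₁ : DDT n) →
      error R (queryᴰ i D₀ D₁) + error R (queryᴰ i D₀ D₁) ≡
      error (restrict i false R) (restrictᴰ i false D₀) + error (restrict i true R) (restrictᴰ i true D₁)
    error-restrict-query i R D₀ D₁ = trans (error-restrict i R D) (cong₂ _+_
      (error-cong {D = restrictᴰ i false D} {restrictᴰ i false D₀} (λ _ → refl)
        (λ x → cong (λ T → mean T x) (restrict-query i false (tree D₀) (tree D₁))))
      (error-cong {D = restrictᴰ i true D} {restrictᴰ i true D₁} (λ _ → refl)
        (λ x → cong (λ T → mean T x) (restrict-query i true (tree D₀) (tree D₁)))))
      where D = queryᴰ i D₀ D₁

    Beats : ∀ {n} → RDT n → K → ℕ → Set _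
    Beats {n} R e k = ∀ (D : DDT n) → queryComplexity (tree D) ℕ.≤ k → e ≤ error R D

    restrict-idempotent : ∀ {n} i b b′ (R : RDT n) x →
      mean (restrict i b′ (restrict i b R)) x ≡ mean (restrict i b R) x
    restrict-idempotent i b b′ R x = trans (mean-restrict i b′ (restrict i b R) x)
      (trans (mean-restrict i b R (x [ i ]≔ b′))
        (trans (cong (mean R) ([]≔-idempotent x i)) (sym (mean-restrict i b R x))))

    -- The restriction S of R ignores x i, so the error of D on S is the mean of the
    -- errors of both restrictions of D.  By optimality of D neither is smaller than
    -- that mean, hence both equal it.
    optimal-restrict : ∀ {n} (i : Fin n) b (R : RDT n) {k} (D : DDT n) →
      queryComplexity (tree D) ℕ.≤ k → Beats (restrict i b R) (error (restrict i b R) D) k →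
      error (restrict i b R) (restrictᴰ i b D) ≡ error (restrict i b R) D
    optimal-restrict {n} i b R {k} D D≤k beats = go b refl
      where
      S = restrict i b R
      pieces : error S D + error S D ≡ error S (restrictᴰ i false D) + error S (restrictᴰ i true D)
      pieces = trans (error-restrict i S D) (cong₂ _+_
        (error-cong {D = restrictᴰ i false D} {restrictᴰ i false D} (restrict-idempotent i b false R) (λ _ → refl))
        (error-cong {D = restrictᴰ i true D} {restrictᴰ i true D} (restrict-idempotent i b true R) (λ _ → refl)))
      bound : ∀ b′ → error S D ≤ error S (restrictᴰ i b′ D)
      bound b′ = beats (restrictᴰ i b′ D) (ℕₚ.≤-trans (queryComplexity-restrict i b′ (tree D)) D≤k)
      -- Both values of b are symmetric, but the order of the summands is not.
      go : ∀ b′ → b′ ≡ b → error S (restrictᴰ i b′ D) ≡ error S D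
      go false _ = mean-lower-bound pieces (bound false) (bound true)
      go true  _ = mean-lower-bound (trans pieces (+-comm _ _)) (bound true) (bound false)

    error-optimal-query : ∀ {n} (i : Fin n) (R : RDT n) {k} (D₀ D₁ : DDT n) →
      queryComplexity (tree D₀) ℕ.≤ k → Beats (restrict i false R) (error (restrict i false R) D₀) k →
      queryComplexity (tree D₁) ℕ.≤ k → Beats (restrict i true R) (error (restrict i true R) D₁) k →
      (error (restrict i false R) D₀ + error (restrict i true R) D₁) * ½ ≡ error R (queryᴰ i D₀ D₁)
    error-optimal-query i R D₀ D₁ D₀≤k beats₀ D₁≤k beats₁ = begin
      (error (restrict i false R) D₀ + error (restrict i true R) D₁) * ½  ≡⟨ *-comm _ ½ ⟩
      ½ * (error (restrict i false R) D₀ + error (restrict i true R) D₁)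
        ≡⟨ cong (½ *_) (cong₂ _+_ (optimal-restrict i false R D₀ D₀≤k beats₀)
                                   (optimal-restrict i true R D₁ D₁≤k beats₁)) ⟨
      ½ * (error (restrict i false R) (restrictᴰ i false D₀) + error (restrict i true R) (restrictᴰ i true D₁))
        ≡⟨ cong (½ *_) (error-restrict-query i R D₀ D₁) ⟨
      ½ * (error R (queryᴰ i D₀ D₁) + error R (queryᴰ i D₀ D₁))  ≡⟨ ½*double _ ⟩
      error R (queryᴰ i D₀ D₁) ∎

    -- The lower bound that makes the recursion complete: restricting the subtrees of
    -- a query node to the value found by the query can only remove queries.
    half≤query : ∀ {n} (i : Fin n) (R : RDT n) {k} {e₀ e₁} →
      Beats (restrict i false R) e₀ k → Beats (restrict i true R) e₁ k →
      ∀ (D₀ D₁ : DDT n) → queryComplexity (tree D₀) ℕ.≤ k → queryComplexity (tree D₁) ℕ.≤ k →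
      (e₀ + e₁) * ½ ≤ error R (queryᴰ i D₀ D₁)
    half≤query i R {e₀ = e₀} {e₁} beats₀ beats₁ D₀ D₁ D₀≤k D₁≤k =
      subst₂ _≤_ (*-comm ½ _) (½*double _)
        (*-monoʳ-≤ 0≤½ (subst (e₀ + e₁ ≤_) (sym (error-restrict-query i R D₀ D₁))
          (+-mono-≤ (beats₀ (restrictᴰ i false D₀) (ℕₚ.≤-trans (queryComplexity-restrict i false (tree D₀)) D₀≤k))
                    (beats₁ (restrictᴰ i true D₁) (ℕₚ.≤-trans (queryComplexity-restrict i true (tree D₁)) D₁≤k)))))

    beats-zero : ∀ {n} {R : RDT n} {e} → (∀ c → e ≤ error R (const c)) → Beats R e 0
    beats-zero e≤const (ddt (leaf c) refl) _ = e≤const c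
    beats-zero e≤const (ddt (coin S T) ())
    beats-zero e≤const (ddt (query i S T) det) ()

    beats-suc : ∀ {n} {R : RDT n} {e} {k} → (∀ c → e ≤ error R (const c)) →
      (∀ i (D₀ D₁ : DDT n) → queryComplexity (tree D₀) ℕ.≤ k → queryComplexity (tree D₁) ℕ.≤ k →
        e ≤ error R (queryᴰ i D₀ D₁)) →
      Beats R e (suc k)
    beats-suc e≤const e≤query (ddt (leaf c) refl) _ = e≤const c
    beats-suc e≤const e≤query (ddt (coin S T) ())
    beats-suc {R = R} {e} e≤const e≤query (ddt (query i S T) det) (s≤s le) =
      subst (λ D → e ≤ error R D) (cong (ddt (query i S T)) (ℕₚ.≡-irrelevant _ det))
        (e≤query i (ddt S detS) (ddt T detT) (ℕₚ.m⊔n≤o⇒m≤o _ _ le) (ℕₚ.m⊔n≤o⇒n≤o _ _ le))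
      where
      det≤0 = ℕₚ.≤-reflexive det
      detS = ℕₚ.n≤0⇒n≡0 (ℕₚ.m⊔n≤o⇒m≤o (randomness S) (randomness T) det≤0)
      detT = ℕₚ.n≤0⇒n≡0 (ℕₚ.m⊔n≤o⇒n≤o (randomness S) (randomness T) det≤0)

    -- Without variables there is nothing to query.
    optimal-zero : ∀ (R : RDT 0) ε q⋆ → IsOptimal 𝓔 R ε q⋆ → q⋆ ≡ 0
    optimal-zero R ε q⋆ ((D , _ , D≤ε) , minimal) = ℕₚ.n≤0⇒n≡0 (minimal 0 (D , noQuery (tree D) , D≤ε))
      where
      noQuery : (T : RDT 0) → queryComplexity T ℕ.≤ 0
      noQuery (leaf _)   = z≤n
      noQuery (coin S T) = ℕₚ.⊔-lub (noQuery S) (noQuery T)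

    -- On one variable every deterministic tree computes the same function as its table
    -- of two entries, which has one query.
    optimal-one : ∀ (R : RDT 1) ε q⋆ → IsOptimal 𝓔 R ε q⋆ → q⋆ ℕ.≤ 1
    optimal-one R ε q⋆ ((D , _ , D≤ε) , minimal) = minimal 1
      (table , s≤s z≤n , subst (_≤ ε) (error-cong {R = R} {D = D} {table} (λ _ → refl) agree) D≤ε)
      where
      answer : Bool → DDT 1
      answer b = const (⟦ D ⟧ (b ∷ []))
      table : DDT 1
      table = queryᴰ zero (answer false) (answer true)
      agree : ∀ x → mean (tree D) x ≡ mean (tree table) x
      agree (false ∷ []) = sym (value-⟦⟧ D (false ∷ []))
      agree (true ∷ [])  = sym (value-⟦⟧ D (true ∷ []))

-- Running times

module Costs {a ℓ} (F : OrderedField a ℓ) where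
  open import Data.Nat.Base using (_+_; _*_; _≤_)
  open ℕₚ
  open Over F hiding (_≤_; _<_)
  open Metric F using (restrict)

  -- A step bound is kept as a literal c, for the rules applied in the body at hand,
  -- together with the list xs of the bounds of the calls it makes.  As derivations
  -- are composed, c and xs are computed by unification, and only one inequality is
  -- left to prove for each function.
  infix 4 _⊢_⇓_⟨_∣_⟩ _·_⇓_⟨_∣_⟩

  record _⊢_⇓_⟨_∣_⟩ {n} (ρ : Vec Value n) (e : Term n) (v : Value) (c : ℕ) (xs : List ℕ) : Set (a ⊔ˡ ℓ) where
    constructor within
    field
      {steps} : ℕ
      evaluation : ρ ⊢ e ⇓ v [ steps ]
      bound : steps ≤ c + sum xs

  record _·_⇓_⟨_∣_⟩ (f u v : Value) (c : ℕ) (xs : List ℕ) : Set (a ⊔ˡ ℓ) where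
    constructor within
    field
      {steps} : ℕ
      evaluation : f · u ⇓ v [ steps ]
      bound : steps ≤ c + sum xs

  combine : ∀ {k l c d} xs ys → k ≤ c + sum xs → l ≤ d + sum ys → k + l ≤ c + d + sum (xs ++ ys)
  combine {k} {l} {c} {d} xs ys k≤ l≤ = begin
    k + l                        ≤⟨ +-mono-≤ k≤ l≤ ⟩
    (c + sum xs) + (d + sum ys)  ≡⟨ regroup c (sum xs) d (sum ys) ⟩
    c + d + (sum xs + sum ys)    ≡⟨ cong (c + d +_) (sum-++ xs ys) ⟨
    c + d + sum (xs ++ ys)       ∎
    where
    open ≤-Reasoning
    regroup : ∀ p q r s → (p + q) + (r + s) ≡ p + r + (q + s)
    regroup = solve-∀

  module _ {n} {ρ : Vec Value n} where
    varᵂ : ∀ {i} → ρ ⊢ var i ⇓ lookup ρ i ⟨ 1 ∣ [] ⟩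
    varᵂ = within ⇓var ≤-refl

    varᵂ≡ : ∀ {i u} → lookup ρ i ≡ u → ρ ⊢ var i ⇓ u ⟨ 1 ∣ [] ⟩
    varᵂ≡ refl = varᵂ

    funᵂ : ∀ {e} → ρ ⊢ fun e ⇓ closure ρ e ⟨ 1 ∣ [] ⟩
    funᵂ = within ⇓fun ≤-refl

    nilᵂ : ρ ⊢ nil ⇓ nil ⟨ 1 ∣ [] ⟩
    nilᵂ = within ⇓nil ≤-refl

    oneᵂ : ρ ⊢ #1 ⇓ num 1# ⟨ 1 ∣ [] ⟩
    oneᵂ = within ⇓1 ≤-refl

    appᵂ : ∀ {e₁ e₂ f u w c₁ c₂ c₃ xs₁ xs₂ xs₃} →
      ρ ⊢ e₁ ⇓ f ⟨ c₁ ∣ xs₁ ⟩ → ρ ⊢ e₂ ⇓ u ⟨ c₂ ∣ xs₂ ⟩ → f · u ⇓ w ⟨ c₃ ∣ xs₃ ⟩ →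
      ρ ⊢ app e₁ e₂ ⇓ w ⟨ suc (c₁ + c₂ + c₃) ∣ (xs₁ ++ xs₂) ++ xs₃ ⟩
    appᵂ {xs₁ = xs₁} {xs₂} {xs₃} (within d₁ b₁) (within d₂ b₂) (within d₃ b₃) =
      within (⇓app d₁ d₂ d₃) (s≤s (combine (xs₁ ++ xs₂) xs₃ (combine xs₁ xs₂ b₁ b₂) b₃))

    consᵂ : ∀ {e₁ e₂ u w c₁ c₂ xs₁ xs₂} →
      ρ ⊢ e₁ ⇓ u ⟨ c₁ ∣ xs₁ ⟩ → ρ ⊢ e₂ ⇓ w ⟨ c₂ ∣ xs₂ ⟩ →
      ρ ⊢ cons e₁ e₂ ⇓ cons u w ⟨ suc (c₁ + c₂) ∣ xs₁ ++ xs₂ ⟩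
    consᵂ {xs₁ = xs₁} {xs₂} (within d₁ b₁) (within d₂ b₂) =
      within (⇓cons d₁ d₂) (s≤s (combine xs₁ xs₂ b₁ b₂))

    case-nilᵂ : ∀ {e e₁ e₂ w c c₁ xs xs₁} →
      ρ ⊢ e ⇓ nil ⟨ c ∣ xs ⟩ → ρ ⊢ e₁ ⇓ w ⟨ c₁ ∣ xs₁ ⟩ →
      ρ ⊢ case e e₁ e₂ ⇓ w ⟨ suc (c + c₁) ∣ xs ++ xs₁ ⟩
    case-nilᵂ {xs = xs} {xs₁} (within d b) (within d₁ b₁) =
      within (⇓case-nil d d₁) (s≤s (combine xs xs₁ b b₁))

    case-consᵂ : ∀ {e e₁ e₂ h t w c c₂ xs xs₂} →
      ρ ⊢ e ⇓ cons h t ⟨ c ∣ xs ⟩ → (h ∷ t ∷ ρ) ⊢ e₂ ⇓ w ⟨ c₂ ∣ xs₂ ⟩ →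
      ρ ⊢ case e e₁ e₂ ⇓ w ⟨ suc (c + c₂) ∣ xs ++ xs₂ ⟩
    case-consᵂ {xs = xs} {xs₂} (within d b) (within d₂ b₂) =
      within (⇓case-cons d d₂) (s≤s (combine xs xs₂ b b₂))

    arithᵂ : ∀ {o e₁ e₂ x y z c₁ c₂ xs₁ xs₂} →
      ρ ⊢ e₁ ⇓ num x ⟨ c₁ ∣ xs₁ ⟩ → ρ ⊢ e₂ ⇓ num y ⟨ c₂ ∣ xs₂ ⟩ → Arith o x y z →
      ρ ⊢ arith o e₁ e₂ ⇓ num z ⟨ suc (c₁ + c₂) ∣ xs₁ ++ xs₂ ⟩
    arithᵂ {xs₁ = xs₁} {xs₂} (within d₁ b₁) (within d₂ b₂) op =
      within (⇓arith d₁ d₂ op) (s≤s (combine xs₁ xs₂ b₁ b₂))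

    leq-trueᵂ : ∀ {e₁ e₂ x y c₁ c₂ xs₁ xs₂} →
      ρ ⊢ e₁ ⇓ num x ⟨ c₁ ∣ xs₁ ⟩ → ρ ⊢ e₂ ⇓ num y ⟨ c₂ ∣ xs₂ ⟩ → OrderedField._≤_ F x y →
      ρ ⊢ leq e₁ e₂ ⇓ cons nil nil ⟨ suc (c₁ + c₂) ∣ xs₁ ++ xs₂ ⟩
    leq-trueᵂ {xs₁ = xs₁} {xs₂} (within d₁ b₁) (within d₂ b₂) x≤y =
      within (⇓leq-true d₁ d₂ x≤y) (s≤s (combine xs₁ xs₂ b₁ b₂))

    leq-falseᵂ : ∀ {e₁ e₂ x y c₁ c₂ xs₁ xs₂} →
      ρ ⊢ e₁ ⇓ num x ⟨ c₁ ∣ xs₁ ⟩ → ρ ⊢ e₂ ⇓ num y ⟨ c₂ ∣ xs₂ ⟩ → ¬ OrderedField._≤_ F x y →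
      ρ ⊢ leq e₁ e₂ ⇓ nil ⟨ suc (c₁ + c₂) ∣ xs₁ ++ xs₂ ⟩
    leq-falseᵂ {xs₁ = xs₁} {xs₂} (within d₁ b₁) (within d₂ b₂) x≰y =
      within (⇓leq-false d₁ d₂ x≰y) (s≤s (combine xs₁ xs₂ b₁ b₂))

    letᵂ : ∀ {e e′ u w c c′ xs xs′} →
      ρ ⊢ e ⇓ u ⟨ c ∣ xs ⟩ → (u ∷ nil ∷ ρ) ⊢ e′ ⇓ w ⟨ c′ ∣ xs′ ⟩ →
      ρ ⊢ letin e e′ ⇓ w ⟨ suc (suc (c + 1) + c′) ∣ (xs ++ []) ++ xs′ ⟩
    letᵂ d d′ = case-consᵂ (consᵂ d nilᵂ) d′

    -- The test is between two literals and is decided by evaluation.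
    pad : ∀ {e w c d xs} → ρ ⊢ e ⇓ w ⟨ c ∣ xs ⟩ → {T (c ℕ.≤ᵇ d)} → ρ ⊢ e ⇓ w ⟨ d ∣ xs ⟩
    pad {c = c} {d} {xs} (within der b) {c≤d} = within der (≤-trans b (+-monoˡ-≤ (sum xs) (≤ᵇ⇒≤ c d c≤d)))

    enter : ∀ {e u w c xs} → (u ∷ closure ρ e ∷ ρ) ⊢ e ⇓ w ⟨ c ∣ xs ⟩ →
      closure ρ e · u ⇓ w ⟨ suc c ∣ xs ⟩
    enter (within d b) = within (·closure d) (s≤s b)

  -- Packs the bound of a body into the bound d + z of a call: the literal d covers
  -- the constant part and z the inner calls.
  relax : ∀ d {f u w c xs z} → f · u ⇓ w ⟨ c ∣ xs ⟩ → {T (c ℕ.≤ᵇ d)} → sum xs ≤ z →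
    f · u ⇓ w ⟨ 0 ∣ d + z ∷ [] ⟩
  relax d {c = c} {xs} {z} (within der b) {c≤d} le = within der (begin
    _               ≤⟨ b ⟩
    c + sum xs      ≤⟨ +-mono-≤ (≤ᵇ⇒≤ c d c≤d) le ⟩
    d + z           ≡⟨ +-identityʳ (d + z) ⟨
    sum (d + z ∷ []) ∎)
    where open ≤-Reasoning

  widen : ∀ {f u w y z} → f · u ⇓ w ⟨ 0 ∣ y ∷ [] ⟩ → y ≤ z → f · u ⇓ w ⟨ 0 ∣ z ∷ [] ⟩
  widen (within der b) y≤z = within der (≤-trans b (+-monoˡ-≤ 0 y≤z))

  bool : Bool → Data
  bool false = nil
  bool true  = cons nil nil

  -- The cost is charged to the second numeral alone, which in a restriction is the
  -- label of a query and hence a part of the tree.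
  equal-run : ∀ {n} {ρ : Vec Value n} x y → let clo = closure ρ (fun equalBody) in
    closure (⌜ encodeℕᵇ x ⌝ ∷ clo ∷ ρ) equalBody · ⌜ encodeℕᵇ y ⌝
      ⇓ ⌜ bool (does (x ℕᵇₚ.≟ y)) ⌝ ⟨ 0 ∣ size (encodeℕᵇ y) * 40 ∷ [] ⟩
  equal-run ℕᵇ.zero ℕᵇ.zero =
    relax 40 (enter (case-nilᵂ varᵂ (case-nilᵂ varᵂ (consᵂ nilᵂ nilᵂ)))) z≤n
  equal-run ℕᵇ.zero 2[1+ y ] =
    relax 160 (enter (case-nilᵂ varᵂ (case-consᵂ varᵂ nilᵂ))) z≤n
  equal-run ℕᵇ.zero 1+[2 y ] =
    relax 80 (enter (case-nilᵂ varᵂ (case-consᵂ varᵂ nilᵂ))) z≤n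
  equal-run 2[1+ x ] ℕᵇ.zero =
    relax 40 (enter (case-consᵂ varᵂ (case-nilᵂ varᵂ nilᵂ))) z≤n
  equal-run 2[1+ x ] 2[1+ y ] =
    relax 160 (enter (case-consᵂ varᵂ (case-consᵂ varᵂ (case-consᵂ varᵂ (case-consᵂ varᵂ
      (appᵂ (appᵂ varᵂ varᵂ (enter funᵂ)) varᵂ (equal-run x y)))))))
      (≤-reflexive (+-identityʳ _))
  equal-run 2[1+ x ] 1+[2 y ] =
    relax 80 (enter (case-consᵂ varᵂ (case-consᵂ varᵂ (case-consᵂ varᵂ (case-nilᵂ varᵂ nilᵂ))))) z≤n
  equal-run 1+[2 x ] ℕᵇ.zero =
    relax 40 (enter (case-consᵂ varᵂ (case-nilᵂ varᵂ nilᵂ))) z≤n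
  equal-run 1+[2 x ] 2[1+ y ] =
    relax 160 (enter (case-consᵂ varᵂ (case-consᵂ varᵂ (case-nilᵂ varᵂ (case-consᵂ varᵂ nilᵂ))))) z≤n
  equal-run 1+[2 x ] 1+[2 y ] =
    relax 80 (enter (case-consᵂ varᵂ (case-consᵂ varᵂ (case-nilᵂ varᵂ (case-nilᵂ varᵂ
      (appᵂ (appᵂ varᵂ varᵂ (enter funᵂ)) varᵂ (equal-run x y)))))))
      (≤-reflexive (+-identityʳ _))

  equal-run-Fin : ∀ {n} (i j : Fin n) m (ρ : Vec Value m) → let clo = closure ρ (fun equalBody) in
    closure (⌜ encodeℕ (toℕ i) ⌝ ∷ clo ∷ ρ) equalBody · ⌜ encodeℕ (toℕ j) ⌝
      ⇓ ⌜ bool (does (i Finₚ.≟ j)) ⌝ ⟨ 0 ∣ size (encodeℕ (toℕ j)) * 40 ∷ [] ⟩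
  equal-run-Fin i j m ρ = subst
    (λ b → closure (⌜ encodeℕ (toℕ i) ⌝ ∷ closure ρ (fun equalBody) ∷ ρ) equalBody · ⌜ encodeℕ (toℕ j) ⌝
      ⇓ ⌜ bool b ⌝ ⟨ 0 ∣ size (encodeℕ (toℕ j)) * 40 ∷ [] ⟩)
    (does-⇔ (mk⇔ (Finₚ.toℕ-injective ∘ ℕᵇₚ.fromℕ-injective) (cong (ℕᵇ.fromℕ ∘ toℕ)))
      (ℕᵇ.fromℕ (toℕ i) ℕᵇₚ.≟ ℕᵇ.fromℕ (toℕ j)) (i Finₚ.≟ j))
    (equal-run (ℕᵇ.fromℕ (toℕ i)) (ℕᵇ.fromℕ (toℕ j)))

  -- The function obtained from restrictT after its first two arguments.
  restrictClosure : ∀ {m} → Vec Value m → ∀ {n} → Fin n → Bool → Value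
  restrictClosure ρ i b =
    let f = closure ρ (fun (fun restrictBody))
        ρ₁ = ⌜ encodeℕ (toℕ i) ⌝ ∷ f ∷ ρ
    in closure (⌜ bool b ⌝ ∷ closure ρ₁ (fun restrictBody) ∷ ρ₁) restrictBody

  -- The comparison of labels and the two recursive calls against the size of a
  -- query node.
  query-cost : ∀ j s t → j * 40 + (s * 100 + (t * 100 + 0)) ≤ (j + suc (s + t)) * 100
  query-cost j s t = begin
    j * 40 + (s * 100 + (t * 100 + 0))   ≤⟨ +-monoˡ-≤ _ (*-monoʳ-≤ j (≤ᵇ⇒≤ 40 100 _)) ⟩
    j * 100 + (s * 100 + (t * 100 + 0))  ≡⟨ collect 100 j s t ⟩
    (j + (s + t)) * 100                  ≤⟨ *-monoˡ-≤ 100 (+-monoʳ-≤ j (n≤1+n (s + t))) ⟩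
    (j + suc (s + t)) * 100              ∎
    where
    open ≤-Reasoning
    collect : ∀ a j s t → j * a + (s * a + (t * a + 0)) ≡ (j + (s + t)) * a
    collect = solve-∀

  restrict-run : ∀ {m} {ρ : Vec Value m} {n} (i : Fin n) b (R : RDT n) →
    restrictClosure ρ i b · ⌜ encodeTree R ⌝ ⇓ ⌜ encodeTree (restrict i b R) ⌝
      ⟨ 0 ∣ size (encodeTree R) * 100 ∷ [] ⟩
  restrict-run i b (leaf u) =
    relax 300 (enter (case-consᵂ varᵂ (case-nilᵂ varᵂ varᵂ))) z≤n
  restrict-run {ρ = ρ} i b (query j S U) = branch b (does (i Finₚ.≟ j)) (equal-run-Fin i j)
    where
    j# s# u# : ℕ
    j# = size (encodeℕ (toℕ j))
    s# = size (encodeTree S)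
    u# = size (encodeTree U)
    -- The result of the comparison is generalised to a boolean e.  The context of the
    -- comparison is left open, as it contains the parts of the node.
    branch : ∀ b e →
      (∀ m (σ : Vec Value m) → closure (⌜ encodeℕ (toℕ i) ⌝ ∷ closure σ (fun equalBody) ∷ σ) equalBody
        · ⌜ encodeℕ (toℕ j) ⌝ ⇓ ⌜ bool e ⌝ ⟨ 0 ∣ j# * 40 ∷ [] ⟩) →
      restrictClosure ρ i b · ⌜ encodeTree (query j S U) ⌝
        ⇓ ⌜ encodeTree (if e then (if b then restrict i b U else restrict i b S)
                        else query j (restrict i b S) (restrict i b U)) ⌝
        ⟨ 0 ∣ 500 + (j# + suc (s# + u#)) * 100 ∷ [] ⟩
    branch b false unequal =
      relax 500 (enter (case-consᵂ varᵂ (case-consᵂ varᵂ (case-nilᵂ varᵂ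
        (case-consᵂ varᵂ (case-consᵂ varᵂ
          (case-nilᵂ (appᵂ (appᵂ funᵂ varᵂ (enter funᵂ)) varᵂ (unequal _ _))
            (consᵂ varᵂ (consᵂ varᵂ (consᵂ
              (appᵂ varᵂ varᵂ (restrict-run i b S))
              (appᵂ varᵂ varᵂ (restrict-run i b U))))))))))))
        (query-cost j# s# u#)
    branch false true equal =
      relax 500 (enter (case-consᵂ varᵂ (case-consᵂ varᵂ (case-nilᵂ varᵂ
        (case-consᵂ varᵂ (case-consᵂ varᵂ
          (case-consᵂ (appᵂ (appᵂ funᵂ varᵂ (enter funᵂ)) varᵂ (equal _ _))
            (case-nilᵂ varᵂ (appᵂ varᵂ varᵂ (restrict-run i false S))))))))))
        (≤-trans (+-monoʳ-≤ (j# * 40) (+-monoʳ-≤ (s# * 100) z≤n)) (query-cost j# s# u#))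
    branch true true equal =
      relax 500 (enter (case-consᵂ varᵂ (case-consᵂ varᵂ (case-nilᵂ varᵂ
        (case-consᵂ varᵂ (case-consᵂ varᵂ
          (case-consᵂ (appᵂ (appᵂ funᵂ varᵂ (enter funᵂ)) varᵂ (equal _ _))
            (case-consᵂ varᵂ (appᵂ varᵂ varᵂ (restrict-run i true U))))))))))
        (≤-trans (+-monoʳ-≤ (j# * 40) (m≤n+m _ (s# * 100))) (query-cost j# s# u#))
  restrict-run i b (coin S U) =
    relax 700 (enter (case-consᵂ varᵂ (case-consᵂ varᵂ (case-consᵂ varᵂ (case-consᵂ varᵂ
      (consᵂ varᵂ (consᵂ (appᵂ varᵂ varᵂ (restrict-run i b S)) (appᵂ varᵂ varᵂ (restrict-run i b U)))))))))
      (≤-reflexive (trans (cong (size (encodeTree S) * 100 +_) (+-identityʳ _))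
        (sym (*-distribʳ-+ 100 (size (encodeTree S)) (size (encodeTree U))))))

  list : List ℕᵇ → Data
  list []       = nil
  list (j ∷ js) = cons (encodeℕᵇ j) (list js)

  children-run : ∀ {m} {ρ : Vec Value m} js →
    closure ρ childrenBody · ⌜ list js ⌝ ⇓ ⌜ list (children js) ⌝ ⟨ 0 ∣ suc (length js) * 40 ∷ [] ⟩
  children-run []       = relax 40 (enter (case-nilᵂ varᵂ nilᵂ)) z≤n
  children-run (j ∷ js) =
    relax 40 (enter (case-consᵂ varᵂ (consᵂ (consᵂ nilᵂ varᵂ)
      (consᵂ (consᵂ (consᵂ nilᵂ nilᵂ) varᵂ) (appᵂ varᵂ varᵂ (children-run js))))))
      (≤-reflexive (+-identityʳ _))

  -- The list of length l built for n is expanded to one for 2 n + 1.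
  below-cost-odd : ∀ n l → l ≡ n → 50 + (suc n * 100 + (suc l * 40 + 0)) ≤ suc (suc (2 * n)) * 100
  below-cost-odd n _ refl = begin
    50 + (suc n * 100 + (suc n * 40 + 0))          ≤⟨ +-monoˡ-≤ _ (m≤n*m 50 (suc n)) ⟩
    suc n * 50 + (suc n * 100 + (suc n * 40 + 0))  ≡⟨ collect (suc n) 50 100 40 ⟩
    suc n * (50 + 100 + 40)                        ≤⟨ *-monoʳ-≤ (suc n) (≤ᵇ⇒≤ 190 200 _) ⟩
    suc n * (2 * 100)                              ≡⟨ regroup 2 (suc n) 100 ⟩
    2 * suc n * 100                                ≡⟨ cong (_* 100) (*-suc 2 n) ⟩
    suc (suc (2 * n)) * 100                        ∎
    where
    open ≤-Reasoning
    collect : ∀ s a b c → s * a + (s * b + (s * c + 0)) ≡ s * (a + b + c)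
    collect = solve-∀
    regroup : ∀ a s b → s * (a * b) ≡ a * s * b
    regroup = solve-∀

  below-cost-even : ∀ n l → l ≡ n → 50 + (suc n * 100 + (suc l * 40 + 0)) ≤ suc (2 * suc n) * 100
  below-cost-even n l l≡n = ≤-trans (below-cost-odd n l l≡n)
    (*-monoˡ-≤ 100 (≤-trans (n≤1+n _) (≤-reflexive (cong suc (sym (*-suc 2 n))))))

  below-run : ∀ {m} {ρ : Vec Value m} n →
    closure ρ belowBody · ⌜ encodeℕᵇ n ⌝ ⇓ ⌜ list (below n) ⌝ ⟨ 0 ∣ suc (ℕᵇ.toℕ n) * 100 ∷ [] ⟩
  below-run ℕᵇ.zero = relax 100 (enter (case-nilᵂ varᵂ nilᵂ)) z≤n
  below-run 1+[2 n ] = widen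
    (relax 50 (enter (case-consᵂ varᵂ (letᵂ
      (consᵂ nilᵂ (appᵂ funᵂ (appᵂ varᵂ varᵂ (below-run n)) (children-run (below n))))
      (case-nilᵂ varᵂ varᵂ)))) ≤-refl)
    (below-cost-odd (ℕᵇ.toℕ n) (length (below n)) (length-below n))
  below-run 2[1+ n ] = widen
    (relax 50 (enter (case-consᵂ varᵂ (letᵂ
      (consᵂ nilᵂ (appᵂ funᵂ (appᵂ varᵂ varᵂ (below-run n)) (children-run (below n))))
      (case-consᵂ varᵂ (consᵂ (consᵂ nilᵂ varᵂ) varᵂ))))) ≤-refl)
    (below-cost-even (ℕᵇ.toℕ n) (length (below n)) (length-below n))

module Determinism {a ℓ} (F : OrderedField a ℓ) where
  open Over F

  Arith-functional : ∀ {o x y z z′} → Arith o x y z → Arith o x y z′ → z ≡ z′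
  Arith-functional add     add     = refl
  Arith-functional sub     sub     = refl
  Arith-functional mul     mul     = refl
  Arith-functional (div _) (div _) = refl

  mutual
    -- This is what allows all runs of a program to share the value that one of them
    -- loads.
    ⇓-functional : ∀ {n} {ρ : Vec Value n} {e u w k l} → ρ ⊢ e ⇓ u [ k ] → ρ ⊢ e ⇓ w [ l ] → u ≡ w
    ⇓-functional ⇓var ⇓var = refl
    ⇓-functional ⇓fun ⇓fun = refl
    ⇓-functional (⇓app d₁ d₂ d₃) (⇓app d₁′ d₂′ d₃′)
      with refl ← ⇓-functional d₁ d₁′ | refl ← ⇓-functional d₂ d₂′ = ·-functional d₃ d₃′
    ⇓-functional ⇓nil ⇓nil = refl
    ⇓-functional (⇓cons d₁ d₂) (⇓cons d₁′ d₂′) = cong₂ cons (⇓-functional d₁ d₁′) (⇓-functional d₂ d₂′)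
    ⇓-functional (⇓case-nil _ d₁) (⇓case-nil _ d₁′) = ⇓-functional d₁ d₁′
    ⇓-functional (⇓case-nil d _) (⇓case-cons d′ _) with () ← ⇓-functional d d′
    ⇓-functional (⇓case-cons d _) (⇓case-nil d′ _) with () ← ⇓-functional d d′
    ⇓-functional (⇓case-cons d d₂) (⇓case-cons d′ d₂′) with refl ← ⇓-functional d d′ = ⇓-functional d₂ d₂′
    ⇓-functional ⇓0 ⇓0 = refl
    ⇓-functional ⇓1 ⇓1 = refl
    ⇓-functional (⇓arith d₁ d₂ op) (⇓arith d₁′ d₂′ op′)
      with refl ← ⇓-functional d₁ d₁′ | refl ← ⇓-functional d₂ d₂′ = cong num (Arith-functional op op′)
    ⇓-functional (⇓leq-true _ _ _) (⇓leq-true _ _ _) = refl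
    ⇓-functional (⇓leq-true d₁ d₂ x≤y) (⇓leq-false d₁′ d₂′ x≰y)
      with refl ← ⇓-functional d₁ d₁′ | refl ← ⇓-functional d₂ d₂′ = ⊥-elim (x≰y x≤y)
    ⇓-functional (⇓leq-false d₁ d₂ x≰y) (⇓leq-true d₁′ d₂′ x≤y)
      with refl ← ⇓-functional d₁ d₁′ | refl ← ⇓-functional d₂ d₂′ = ⊥-elim (x≰y x≤y)
    ⇓-functional (⇓leq-false _ _ _) (⇓leq-false _ _ _) = refl

    ·-functional : ∀ {f u w w′ k l} → f · u ⇓ w [ k ] → f · u ⇓ w′ [ l ] → w ≡ w′
    ·-functional (·closure d) (·closure d′) = ⇓-functional d d′

module DescriptionLength {a ℓ} (F : OrderedField a ℓ) where
  open import Data.Nat.Base using (_+_; _≤_)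
  open ℕₚ
  open Over F hiding (_≤_; _<_)
  open Metric F using (restrict)

  size-restrict : ∀ {n} i b (R : RDT n) → size (encodeTree (restrict i b R)) ≤ size (encodeTree R)
  size-restrict i b (leaf u) = ≤-refl
  size-restrict i b (query j S U) with does (i Finₚ.≟ j)
  ... | false = +-monoʳ-≤ 5 (+-monoʳ-≤ (size (encodeℕ (toℕ j))) (s≤s (+-mono-≤ (size-restrict i b S) (size-restrict i b U))))
  size-restrict i false (query j S U) | true = m≤n⇒m≤o+n 5 (m≤n⇒m≤o+n (size (encodeℕ (toℕ j)))
    (m≤n⇒m≤1+n (m≤n⇒m≤n+o (size (encodeTree U)) (size-restrict i false S))))
  size-restrict i true  (query j S U) | true = m≤n⇒m≤o+n 5 (m≤n⇒m≤o+n (size (encodeℕ (toℕ j)))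
    (m≤n⇒m≤1+n (m≤n⇒m≤o+n (size (encodeTree S)) (size-restrict i true U))))
  size-restrict i b (coin S U) = +-monoʳ-≤ 7 (+-mono-≤ (size-restrict i b S) (size-restrict i b U))

  3≤size : ∀ {n} (R : RDT n) → 3 ≤ size (encodeTree R)
  3≤size (leaf u)      = ≤-refl
  3≤size (query j S U) = s≤s (s≤s (s≤s z≤n))
  3≤size (coin S U)    = s≤s (s≤s (s≤s z≤n))

  const-shortest : ∀ {n} c (R : RDT n) → descriptionLength (tree {n} (const c)) ≤ descriptionLength R
  const-shortest {n} c R = s≤s (+-monoʳ-≤ (size (encodeℕ n)) (3≤size R))

-- Analysis of the search

module BestTree {a ℓ} (F : OrderedField a ℓ) where
  open import Data.Nat.Base using (_+_; _*_; _^_; _≤_)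
  open ℕₚ
  open Over F hiding (_≤_; _<_)
  open Metric F
  open Costs F
  open DescriptionLength F
  private module F = OrderedField F

  -- Vᵉ and Vᶜ are the function values of the two given programs, and Eᵗ and Cᵗ bound
  -- the cost of a call on inputs of length at most N.  Restrictions of the input
  -- tree and constant trees stay within that length.
  module Budgeted (𝓔 : ErrorMetric) (natural : Natural 𝓔) (n q N Eᵗ Cᵗ : ℕ) (Vᵉ Vᶜ : Value)
    (constant-run : ∀ (R : RDT n) → queryComplexity R ≤ q → descriptionLength R ≤ N →
      ∃ λ c → Minimizes 𝓔 R c × Vᶜ · ⌜ describe R ⌝ ⇓ num (value c) ⟨ 0 ∣ Cᵗ ∷ [] ⟩)
    (error-run : ∀ (R : RDT n) (D : DDT n) → queryComplexity R ≤ q → descriptionLength R ≤ N →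
      descriptionLength (tree D) ≤ N →
      Vᵉ · ⌜ cons (describe R) (describe (tree D)) ⌝ ⇓ num (value (𝓔 R D)) ⟨ 0 ∣ Eᵗ ∷ [] ⟩)
    where
    open NaturalMetric 𝓔 natural

    -- The cost of one branch of the recursion: two restrictions, each at most N * 100,
    -- and one computation of a best constant and its error.
    Q : ℕ
    Q = 400 + (N * 100 + (N * 100 + (Cᵗ + Eᵗ)))

    -- Each of the n iterations makes two recursive calls of cost bestTime k, and a
    -- third share pays for the rest of it, because Q is at most bestTime k.  One more
    -- iteration pays for the enumeration and for the constant tree.
    B : ℕ
    B = 3 * suc n

    bestTime : ℕ → ℕ
    bestTime k = B ^ k * Q

    -- Two restrictions and two recursive calls, and the constant tree with which the
    -- loop ends.
    iteration : ℕ → ℕ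
    iteration k = 100 + (N * 100 + (bestTime k + (N * 100 + (bestTime k + (Cᵗ + (Eᵗ + 0))))))

    leaf-cost : ∀ k → 50 + (Cᵗ + (Eᵗ + 0)) ≤ 1 * iteration k
    leaf-cost k = ≤-trans
      (+-mono-≤ (≤ᵇ⇒≤ 50 100 _) (m≤n⇒m≤o+n (N * 100) (m≤n⇒m≤o+n (bestTime k)
        (m≤n⇒m≤o+n (N * 100) (m≤n⇒m≤o+n (bestTime k) ≤-refl)))))
      (≤-reflexive (sym (+-identityʳ (iteration k))))

    cons-cost : ∀ k l → 100 + (l * iteration k + (N * 100 + (bestTime k + (N * 100 + (bestTime k + 0)))))
      ≤ suc l * iteration k
    cons-cost k l = begin
      100 + (l * iteration k + calls 0)  ≡⟨ swap 100 (l * iteration k) (calls 0) ⟩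
      (100 + calls 0) + l * iteration k  ≤⟨ +-monoˡ-≤ (l * iteration k) (+-monoʳ-≤ 100
                                              (+-monoʳ-≤ (N * 100) (+-monoʳ-≤ (bestTime k)
                                                (+-monoʳ-≤ (N * 100) (+-monoʳ-≤ (bestTime k) z≤n))))) ⟩
      suc l * iteration k                ∎
      where
      open ≤-Reasoning
      calls : ℕ → ℕ
      calls x = N * 100 + (bestTime k + (N * 100 + (bestTime k + x)))
      swap : ∀ x y z → x + (y + z) ≡ (x + z) + y
      swap x y z = trans (cong (x +_) (+-comm y z)) (sym (+-assoc x z y))

    bestTime-mono : ∀ {k l} → k ≤ l → bestTime k ≤ bestTime l
    bestTime-mono k≤l = *-monoˡ-≤ Q (^-monoʳ-≤ B k≤l)

    Q≤bestTime : ∀ k → Q ≤ bestTime k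
    Q≤bestTime k = ≤-trans (m≤m+n Q 0) (bestTime-mono (z≤n {k}))

    best-cost-zero : 100 + (Cᵗ + (Eᵗ + 0)) ≤ bestTime 0
    best-cost-zero = ≤-trans
      (+-mono-≤ (≤ᵇ⇒≤ 100 400 _) (m≤n⇒m≤o+n (N * 100) (m≤n⇒m≤o+n (N * 100)
        (+-monoʳ-≤ Cᵗ (≤-reflexive (+-identityʳ Eᵗ))))))
      (Q≤bestTime 0)

    iteration≤bestTime : ∀ k → 140 + iteration k ≤ 3 * bestTime k
    iteration≤bestTime k = begin
      140 + iteration k      ≤⟨ +-monoˡ-≤ _ (≤ᵇ⇒≤ 240 400 _) ⟩
      400 + (x + (t + (x + (t + (Cᵗ + (Eᵗ + 0))))))  ≡⟨ collect 400 x t Cᵗ Eᵗ ⟩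
      Q + (t + (t + 0))      ≤⟨ +-monoˡ-≤ _ (Q≤bestTime k) ⟩
      3 * bestTime k         ∎
      where
      open ≤-Reasoning
      x = N * 100
      t = bestTime k
      collect : ∀ a x t c e → a + (x + (t + (x + (t + (c + (e + 0)))))) ≡ a + (x + (x + (c + e))) + (t + (t + 0))
      collect = solve-∀

    -- m and l are the number of variables as seen by the enumeration and by the loop;
    -- both equal n only up to conversion from binary.
    best-cost-suc : ∀ k m l → m ≡ n → l ≡ n → 40 + (suc m * 100 + (suc l * iteration k + 0)) ≤ bestTime (suc k)
    best-cost-suc k _ _ refl refl = begin
      40 + (suc n * 100 + (suc n * iteration k + 0))  ≤⟨ +-monoˡ-≤ _ (m≤n*m 40 (suc n)) ⟩
      suc n * 40 + (suc n * 100 + (suc n * iteration k + 0))  ≡⟨ collect (suc n) 40 100 (iteration k) ⟩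
      suc n * (40 + 100 + iteration k)  ≤⟨ *-monoʳ-≤ (suc n) (iteration≤bestTime k) ⟩
      suc n * (3 * (B ^ k * Q))         ≡⟨ regroup 3 (suc n) (B ^ k) Q ⟩
      bestTime (suc k)                  ∎
      where
      open ≤-Reasoning
      collect : ∀ s a b i → s * a + (s * b + (s * i + 0)) ≡ s * (a + b + i)
      collect = solve-∀
      regroup : ∀ c s p q → s * (c * (p * q)) ≡ c * s * p * q
      regroup = solve-∀

    search-cost-last : ∀ j k l → k ≤ l → 50 + (bestTime k + 0) ≤ suc j * (50 + bestTime l)
    search-cost-last j k l k≤l = begin
      50 + (bestTime k + 0)      ≡⟨ cong (50 +_) (+-identityʳ (bestTime k)) ⟩
      50 + bestTime k            ≤⟨ +-monoʳ-≤ 50 (bestTime-mono k≤l) ⟩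
      50 + bestTime l            ≤⟨ m≤n*m (50 + bestTime l) (suc j) ⟩
      suc j * (50 + bestTime l)  ∎
      where open ≤-Reasoning

    search-cost-step : ∀ j k l → k ≤ l →
      50 + (bestTime k + (suc j * (50 + bestTime l) + 0)) ≤ suc (suc j) * (50 + bestTime l)
    search-cost-step j k l k≤l = begin
      50 + (bestTime k + (suc j * (50 + bestTime l) + 0))
        ≡⟨ cong (λ r → 50 + (bestTime k + r)) (+-identityʳ (suc j * (50 + bestTime l))) ⟩
      50 + (bestTime k + suc j * (50 + bestTime l))
        ≤⟨ +-monoʳ-≤ 50 (+-monoˡ-≤ _ (bestTime-mono k≤l)) ⟩
      suc (suc j) * (50 + bestTime l) ∎
      where open ≤-Reasoning

    unary : ℕ → Data
    unary zero    = nil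
    unary (suc k) = cons nil (unary k)

    result : RDT n → DDT n → Value
    result R D = ⌜ cons (num (error R D)) (encodeTree (tree D)) ⌝

    dl-restrict : ∀ i b (R : RDT n) → descriptionLength R ≤ N → descriptionLength (restrict i b R) ≤ N
    dl-restrict i b R = ≤-trans (s≤s (+-monoʳ-≤ (size (encodeℕ n)) (size-restrict i b R)))

    tree≤N : ∀ (R : RDT n) → descriptionLength R ≤ N → size (encodeTree R) ≤ N
    tree≤N R = ≤-trans (m≤n⇒m≤1+n (m≤n+m _ _))

    -- The term is used in two contexts, so the positions of its variables are
    -- parameters.
    leaf-run : ∀ {m} {ρ : Vec Value m} {t s c e} (R : RDT n) →
      queryComplexity R ≤ q → descriptionLength R ≤ N →
      lookup ρ t ≡ ⌜ encodeTree R ⌝ → lookup ρ s ≡ ⌜ encodeℕ n ⌝ → lookup ρ c ≡ Vᶜ → lookup ρ e ≡ Vᵉ →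
      ∃ λ b → Minimizes 𝓔 R b ×
        ρ ⊢ leafT t s c e ⇓ result R (const b) ⟨ 21 ∣ Cᵗ ∷ Eᵗ ∷ [] ⟩
    leaf-run R R≤q R≤N t≡ s≡ c≡ e≡ with constant-run R R≤q R≤N
    ... | b , minimal , computes = b , minimal ,
      letᵂ (consᵂ nilᵂ (appᵂ (varᵂ≡ c≡) (consᵂ (varᵂ≡ s≡) (varᵂ≡ t≡)) computes))
        (consᵂ (appᵂ (varᵂ≡ e≡)
          (consᵂ (consᵂ (varᵂ≡ s≡) (varᵂ≡ t≡)) (consᵂ (varᵂ≡ s≡) varᵂ))
          (error-run R (const b) R≤q R≤N (≤-trans (const-shortest b R) R≤N)))
          varᵂ)

    -- base is the context in which the search is defined: v₁, v₂, v₃ and v₄ stand for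
    -- the input tree, its description, ε and the whole input, the others for the
    -- closures of the program itself.
    module Search (v₁ v₂ v₃ v₄ v₅ v₇ v₉ : Value) where

      base : Vec Value 10
      base = ⌜ encodeℕ n ⌝ ∷ v₁ ∷ v₂ ∷ v₃ ∷ v₄ ∷ v₅ ∷ Vᶜ ∷ v₇ ∷ Vᵉ ∷ v₉ ∷ []

      Vbest : Value
      Vbest = closure base (fun bestBody)

      searchEnv : Vec Value 12
      searchEnv = Vbest ∷ nil ∷ base

      bestOf : ℕ → Value
      bestOf k = closure (⌜ unary k ⌝ ∷ Vbest ∷ base) bestBody

      loopEnv : ℕ → RDT n → Vec Value 16
      loopEnv k R = nil ∷ ⌜ unary k ⌝ ∷ ⌜ encodeTree R ⌝ ∷ bestOf (suc k) ∷ ⌜ unary (suc k) ⌝ ∷ Vbest ∷ base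

      record Best (k : ℕ) (R : RDT n) : Set (a ⊔ˡ ℓ) where
        field
          best    : DDT n
          shallow : queryComplexity (tree best) ≤ k
          optimal : Beats R (error R best) k
          found   : bestOf k · ⌜ encodeTree R ⌝ ⇓ result R best ⟨ 0 ∣ bestTime k ∷ [] ⟩

      -- The state of the loop: the tree found beats the constants and the trees that
      -- first query a variable of the list js.
      record BestAmong (k : ℕ) (R : RDT n) (js : List ℕᵇ) : Set (a ⊔ˡ ℓ) where
        field
          best    : DDT n
          shallow : queryComplexity (tree best) ≤ suc k
          ≤const  : ∀ c → error R best F.≤ error R (const c)
          ≤query  : ∀ i → ℕᵇ.fromℕ (toℕ i) ∈ js → ∀ D₀ D₁ →
            queryComplexity (tree D₀) ≤ k → queryComplexity (tree D₁) ≤ k →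
            error R best F.≤ error R (queryᴰ i D₀ D₁)
          found   : closure (loopEnv k R) loopBody · ⌜ list js ⌝ ⇓ result R best
            ⟨ 0 ∣ suc (length js) * iteration k ∷ [] ⟩

      candidate-run : ∀ {m} {ρ : Vec Value m} {e e′ x y c c′ xs xs′} →
        ρ ⊢ e ⇓ num x ⟨ c ∣ xs ⟩ → ρ ⊢ e′ ⇓ num y ⟨ c′ ∣ xs′ ⟩ →
        ρ ⊢ halfT e e′ ⇓ num ((x F.+ y) F.* F.½) ⟨ _ ∣ (xs ++ xs′) ++ [] ⟩
      candidate-run d d′ = arithᵂ (arithᵂ d d′ add) (arithᵂ oneᵂ oneᵂ add) (div F.2≢0)

      loop-run : ∀ k → (∀ R → queryComplexity R ≤ q → descriptionLength R ≤ N → Best k R) →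
        ∀ R → queryComplexity R ≤ q → descriptionLength R ≤ N →
        ∀ {js} → All (λ b → ∃ λ (i : Fin n) → Represents b i) js → BestAmong k R js
      loop-run k IH R R≤q R≤N [] =
        let b , minimal , computes = leaf-run {ρ = nil ∷ closure (loopEnv k R) loopBody ∷ loopEnv k R}
               {ix 4} {ix 8} {ix 14} {ix 16} R R≤q R≤N refl refl refl refl
        in record
        { best = const b ; shallow = z≤n ; ≤const = minimal ; ≤query = λ i ()
        ; found = widen (relax 50 (enter (case-nilᵂ varᵂ computes)) ≤-refl) (leaf-cost k) }
      loop-run k IH R R≤q R≤N {j ∷ js} ((i , refl) ∷ js-represent) = conclude (error R rest.best F.≤? half)
        where
        R₀ = restrict i false R
        R₁ = restrict i true R
        module rest = BestAmong (loop-run k IH R R≤q R≤N js-represent)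
        module B₀ = Best (IH R₀ (≤-trans (queryComplexity-restrict i false R) R≤q) (dl-restrict i false R R≤N))
        module B₁ = Best (IH R₁ (≤-trans (queryComplexity-restrict i true R) R≤q) (dl-restrict i true R R≤N))
        new = queryᴰ i B₀.best B₁.best
        half = (error R₀ B₀.best F.+ error R₁ B₁.best) F.* F.½
        half≡ : half ≡ error R new
        half≡ = error-optimal-query i R B₀.best B₁.best B₀.shallow B₀.optimal B₁.shallow B₁.optimal
        half≤ : ∀ D₀ D₁ → queryComplexity (tree D₀) ≤ k → queryComplexity (tree D₁) ≤ k →
          half F.≤ error R (queryᴰ i D₀ D₁)
        half≤ = half≤query i R B₀.optimal B₁.optimal
        restricted : ∀ b {m} {ρ : Vec Value m} → restrictClosure ρ i b · ⌜ encodeTree R ⌝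
          ⇓ ⌜ encodeTree (restrict i b R) ⌝ ⟨ 0 ∣ N * 100 ∷ [] ⟩
        restricted b = widen (restrict-run i b R) (*-monoˡ-≤ 100 (tree≤N R R≤N))
        -- A run of the loop body up to the comparison of the new candidate with the best
        -- one among the further indices; both outcomes continue from here.
        compared : ∀ {w} →
          (∀ {ρ : Vec Value 19} → (num half ∷ nil ∷ num (error R₁ B₁.best) ∷ ⌜ encodeTree (tree B₁.best) ⌝
              ∷ num (error R₀ B₀.best) ∷ ⌜ encodeTree (tree B₀.best) ⌝ ∷ num (error R rest.best)
              ∷ ⌜ encodeTree (tree rest.best) ⌝ ∷ ⌜ encodeℕ (toℕ i) ⌝ ∷ ρ)
            ⊢ keepBetter ⇓ w ⟨ 15 ∣ [] ⟩) →
          closure (loopEnv k R) loopBody · ⌜ list (ℕᵇ.fromℕ (toℕ i) ∷ js) ⌝ ⇓ w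
            ⟨ 0 ∣ suc (suc (length js)) * iteration k ∷ [] ⟩
        compared keep = widen
          (relax 100 (enter (case-consᵂ varᵂ (case-consᵂ (appᵂ varᵂ varᵂ rest.found)
            (case-consᵂ (appᵂ (appᵂ varᵂ varᵂ (enter funᵂ))
                (appᵂ (appᵂ (appᵂ funᵂ varᵂ (enter funᵂ)) nilᵂ (enter funᵂ)) varᵂ (restricted false))
                B₀.found)
            (case-consᵂ (appᵂ (appᵂ varᵂ varᵂ (enter funᵂ))
                (appᵂ (appᵂ (appᵂ funᵂ varᵂ (enter funᵂ)) (consᵂ nilᵂ nilᵂ) (enter funᵂ)) varᵂ (restricted true))
                B₁.found)
            (letᵂ (candidate-run varᵂ varᵂ) keep)))))) ≤-refl)
          (cons-cost k (suc (length js)))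
        ≤query-cons : ∀ {e} → (∀ i′ → ℕᵇ.fromℕ (toℕ i′) ∈ js → ∀ D₀ D₁ →
            queryComplexity (tree D₀) ≤ k → queryComplexity (tree D₁) ≤ k → e F.≤ error R (queryᴰ i′ D₀ D₁)) →
          e F.≤ half →
          ∀ i′ → ℕᵇ.fromℕ (toℕ i′) ∈ ℕᵇ.fromℕ (toℕ i) ∷ js → ∀ D₀ D₁ →
            queryComplexity (tree D₀) ≤ k → queryComplexity (tree D₁) ≤ k → e F.≤ error R (queryᴰ i′ D₀ D₁)
        ≤query-cons e≤rest e≤half i′ (there i′∈) = e≤rest i′ i′∈
        ≤query-cons e≤rest e≤half i′ (here i′≡) D₀ D₁ D₀≤k D₁≤k =
          subst (λ i″ → _ F.≤ error R (queryᴰ i″ D₀ D₁))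
            (sym (Finₚ.toℕ-injective (ℕᵇₚ.fromℕ-injective i′≡)))
            (F.≤-trans e≤half (half≤ D₀ D₁ D₀≤k D₁≤k))
        conclude : Dec (error R rest.best F.≤ half) → BestAmong k R (ℕᵇ.fromℕ (toℕ i) ∷ js)
        conclude (yes old≤new) = record
          { best = rest.best ; shallow = rest.shallow ; ≤const = rest.≤const
          ; ≤query = ≤query-cons rest.≤query old≤new
          ; found = compared (pad (case-consᵂ (leq-trueᵂ varᵂ varᵂ old≤new) (consᵂ varᵂ varᵂ))) }
        conclude (no old≰new) = record
          { best = new ; shallow = s≤s (⊔-lub B₀.shallow B₁.shallow)
          ; ≤const = λ c → F.≤-trans new≤old (rest.≤const c)
          ; ≤query = ≤query-cons (λ i′ i′∈ D₀ D₁ D₀≤k D₁≤k → F.≤-trans new≤old (rest.≤query i′ i′∈ D₀ D₁ D₀≤k D₁≤k))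
              (F.≤-reflexive (sym half≡))
          ; found = subst (λ e → closure (loopEnv k R) loopBody · ⌜ list (ℕᵇ.fromℕ (toℕ i) ∷ js) ⌝ ⇓
                ⌜ cons (num e) (encodeTree (tree new)) ⌝ ⟨ 0 ∣ suc (suc (length js)) * iteration k ∷ [] ⟩)
              half≡
              (compared (case-nilᵂ (leq-falseᵂ varᵂ varᵂ old≰new)
                (consᵂ varᵂ (consᵂ (consᵂ nilᵂ nilᵂ) (consᵂ varᵂ (consᵂ varᵂ varᵂ)))))) }
          where
          new≤old : error R new F.≤ error R rest.best
          new≤old with F.total (error R rest.best) half
          ... | inj₁ old≤half = ⊥-elim (old≰new old≤half)
          ... | inj₂ half≤old = subst (F._≤ error R rest.best) half≡ half≤old

      best-run : ∀ k (R : RDT n) → queryComplexity R ≤ q → descriptionLength R ≤ N → Best k R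
      best-run zero R R≤q R≤N =
        let b , minimal , computes = leaf-run {ρ = ⌜ encodeTree R ⌝ ∷ bestOf 0 ∷ nil ∷ Vbest ∷ base}
               {ix 0} {ix 4} {ix 10} {ix 12} R R≤q R≤N refl refl refl refl
        in record
        { best = const b ; shallow = z≤n ; optimal = beats-zero minimal
        ; found = widen (relax 100 (enter (case-nilᵂ varᵂ computes)) ≤-refl) best-cost-zero }
      best-run (suc k) R R≤q R≤N = record
        { best = loop.best ; shallow = loop.shallow
        ; optimal = beats-suc loop.≤const (λ i → loop.≤query i (fromℕ-toℕ-< i))
        ; found = widen (relax 40 (enter (case-consᵂ varᵂ
            (appᵂ funᵂ (appᵂ funᵂ varᵂ (below-run (ℕᵇ.fromℕ n))) loop.found))) ≤-refl)
            (best-cost-suc k (ℕᵇ.toℕ (ℕᵇ.fromℕ n)) (length (below (ℕᵇ.fromℕ n)))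
              toℕ≡ (trans (length-below (ℕᵇ.fromℕ n)) toℕ≡)) }
        where
        module loop = BestAmong (loop-run k (best-run k) R R≤q R≤N (below-represents n))
        toℕ≡ : ℕᵇ.toℕ (ℕᵇ.fromℕ n) ≡ n
        toℕ≡ = ℕᵇₚ.toℕ-fromℕ n

    module Top (R : RDT n) (R≤q : queryComplexity R ≤ q) (R≤N : descriptionLength R ≤ N) (ε : K)
      (w₂ w₃ w₄ w₅ : Value) (q⋆ : ℕ) (q⋆-optimal : IsOptimal 𝓔 R ε q⋆) where
      open Search ⌜ encodeTree R ⌝ ⌜ describe R ⌝ (num ε) w₂ w₃ w₄ w₅

      -- j counts down the rounds that remain before q⋆.  If no tree was accurate enough
      -- when j reaches zero, optimality of the last one would contradict that q⋆ is
      -- achievable; and an accurate tree found earlier has at most q⋆ queries anyway.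
      search-run : ∀ j k → j + k ≡ q⋆ → ∃ λ (D : DDT n) →
        queryComplexity (tree D) ≤ q⋆ × error R D F.≤ ε ×
        (closure searchEnv searchBody · ⌜ unary k ⌝ ⇓ ⌜ describe (tree D) ⌝
          ⟨ 0 ∣ suc j * (50 + bestTime q⋆) ∷ [] ⟩)
      search-run j k j+k≡q⋆ = conclude j j+k≡q⋆ (error R B.best F.≤? ε)
        where
        module B = Best (best-run k R R≤q R≤N)
        k≤q⋆ : k ≤ q⋆
        k≤q⋆ = subst (k ≤_) j+k≡q⋆ (m≤n+m k j)
        conclude : ∀ j → j + k ≡ q⋆ → Dec (error R B.best F.≤ ε) → ∃ λ (D : DDT n) →
          queryComplexity (tree D) ≤ q⋆ × error R D F.≤ ε ×
          (closure searchEnv searchBody · ⌜ unary k ⌝ ⇓ ⌜ describe (tree D) ⌝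
            ⟨ 0 ∣ suc j * (50 + bestTime q⋆) ∷ [] ⟩)
        conclude j _ (yes B≤ε) = B.best , ≤-trans B.shallow k≤q⋆ , B≤ε ,
          widen (relax 50 (enter (case-consᵂ (appᵂ (appᵂ varᵂ varᵂ (enter funᵂ)) varᵂ B.found)
            (case-consᵂ (leq-trueᵂ varᵂ varᵂ B≤ε) (consᵂ varᵂ varᵂ)))) ≤-refl) (search-cost-last j k q⋆ k≤q⋆)
        conclude zero refl (no B≰ε) =
          let (D , D≤q⋆ , D≤ε) , _ = q⋆-optimal
          in ⊥-elim (B≰ε (F.≤-trans (B.optimal D D≤q⋆) D≤ε))
        conclude (suc j) j+k≡q⋆ (no B≰ε) =
          let D , D≤q⋆ , D≤ε , runs = search-run j (suc k) (trans (+-suc j k) j+k≡q⋆)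
          in D , D≤q⋆ , D≤ε ,
          widen (relax 50 (enter (case-consᵂ (appᵂ (appᵂ varᵂ varᵂ (enter funᵂ)) varᵂ B.found)
            (case-nilᵂ (leq-falseᵂ varᵂ varᵂ B≰ε) (appᵂ varᵂ (consᵂ nilᵂ varᵂ) runs)))) ≤-refl) (search-cost-step j k q⋆ k≤q⋆)

-- Assembling the algorithm

module InstanceOpt {a ℓ} (F : OrderedField a ℓ) where
  open import Data.Nat.Base using (_+_; _*_; _^_; _≤_)
  open ℕₚ
  open Over F hiding (_≤_; _<_)
  open Metric F
  open Costs F
  open Determinism F
  open DescriptionLength F using (const-shortest)

  module _ (𝓔 : ErrorMetric) (t : ℕ → ℕ) (natural : Natural 𝓔)
    (Pᵉ Pᶜ : Program) (pᵉ : Poly 3) (pᶜ : Poly 2)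
    (computesE : ComputesError 𝓔 t Pᵉ pᵉ) (computesC : ComputesBestConstant 𝓔 t Pᶜ pᶜ)
    {n : ℕ} (q : ℕ) (R : RDT n) (ε : K) (R≤q : queryComplexity R ≤ q)
    (q⋆ : ℕ) (optimal : IsOptimal 𝓔 R ε q⋆) where

    N Cᵗ Eᵗ : ℕ
    N  = descriptionLength R
    Eᵗ = ⟦ pᵉ ⟧ₚ (t q ∷ N ∷ N ∷ [])
    Cᵗ = ⟦ pᶜ ⟧ₚ (t q ∷ N ∷ [])
    c = proj₁ (computesC q R R≤q)
    module RunC = _on_returns_within_ (proj₂ (proj₂ (computesC q R R≤q)))
    module RunE = _on_returns_within_ (computesE q R (const c) R≤q)

    -- The value loaded in one run serves for every other run.
    rerun : ∀ {P f x y k b b′} → [] ⊢ P ⇓ f [ k ] → P on x returns y within b → b ≤ b′ →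
      f · ⌜ x ⌝ ⇓ ⌜ y ⌝ ⟨ 0 ∣ b′ ∷ [] ⟩
    rerun loads (run {load = l} {s} loads′ applies within-b) b≤b′ with refl ← ⇓-functional loads loads′ =
      within applies (≤-trans (m≤n+m s l) (≤-trans within-b (≤-trans b≤b′ (m≤m+n _ 0))))

    constant-run : ∀ (R′ : RDT n) → queryComplexity R′ ≤ q → descriptionLength R′ ≤ N →
      ∃ λ c′ → Minimizes 𝓔 R′ c′ × RunC.function · ⌜ describe R′ ⌝ ⇓ num (value c′) ⟨ 0 ∣ Cᵗ ∷ [] ⟩
    constant-run R′ R′≤q R′≤N =
      let c′ , minimal , computes = computesC q R′ R′≤q
      in c′ , minimal , rerun RunC.loads computes (⟦⟧ₚ-mono pᶜ (≤-refl ∷ R′≤N ∷ []))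

    error-run : ∀ (R′ : RDT n) (D : DDT n) → queryComplexity R′ ≤ q → descriptionLength R′ ≤ N →
      descriptionLength (tree D) ≤ N →
      RunE.function · ⌜ cons (describe R′) (describe (tree D)) ⌝ ⇓ num (value (𝓔 R′ D)) ⟨ 0 ∣ Eᵗ ∷ [] ⟩
    error-run R′ D R′≤q R′≤N D≤N =
      rerun RunE.loads (computesE q R′ D R′≤q) (⟦⟧ₚ-mono pᵉ (≤-refl ∷ R′≤N ∷ D≤N ∷ []))

    module Best-R = BestTree.Budgeted F 𝓔 natural n q N Eᵗ Cᵗ RunE.function RunC.function
      constant-run error-run

    -- The closures that arise while the algorithm takes its two programs.
    outer middle program : Value
    outer   = closure [] (fun (fun mainBody))
    middle  = closure (RunE.function ∷ outer ∷ []) (fun mainBody)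
    program = closure (RunC.function ∷ middle ∷ RunE.function ∷ outer ∷ []) mainBody

    -- Loading is paid by the running times of the given programs on R itself with its
    -- best constant.
    loaded : [] ⊢ instanceOpt Pᵉ Pᶜ ⇓ program ⟨ 10 ∣ Eᵗ ∷ Cᵗ ∷ [] ⟩
    loaded = pad (appᵂ
      (appᵂ funᵂ (within {c = 0} {xs = Eᵗ ∷ []} RunE.loads (load≤ RunE.withinTime E≤)) (enter funᵂ))
      (within {c = 0} {xs = Cᵗ ∷ []} RunC.loads (load≤ RunC.withinTime ≤-refl)) (enter funᵂ))
      where
      E≤ : ⟦ pᵉ ⟧ₚ (t q ∷ N ∷ descriptionLength (tree {n} (const c)) ∷ []) ≤ Eᵗ
      E≤ = ⟦⟧ₚ-mono pᵉ (≤-refl ∷ ≤-refl ∷ const-shortest c R ∷ [])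
      load≤ : ∀ {l s b b′} → l + s ≤ b → b ≤ b′ → l ≤ b′ + 0
      load≤ l+s≤b b≤b′ = ≤-trans (m≤m+n _ _) (≤-trans l+s≤b (≤-trans b≤b′ (m≤m+n _ 0)))

    time : ∀ l s → l ≤ 10 + (Eᵗ + (Cᵗ + 0)) → s ≤ 50 + (suc q⋆ * (50 + Best-R.bestTime q⋆) + 0) + 0 →
      l + s ≤ ⟦ runningTime pᵉ pᶜ ⟧ₚ (N ∷ t q ∷ n ^ q⋆ ∷ [])
    time l s l≤ s≤ = begin
      l + s  ≤⟨ +-mono-≤ l≤ s≤ ⟩
      10 + (Eᵗ + (Cᵗ + 0)) + (50 + (suc q⋆ * (50 + X * Q) + 0) + 0)
        ≡⟨ regroup 10 50 Eᵗ Cᵗ (suc q⋆ * (50 + X * Q)) ⟩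
      60 + (Eᵗ + (Cᵗ + suc q⋆ * (50 + X * Q)))
        ≤⟨ +-monoʳ-≤ 60 (+-monoʳ-≤ Eᵗ (+-monoʳ-≤ Cᵗ (*-mono-≤ 1+q⋆≤Y (+-monoʳ-≤ 50 (*-monoˡ-≤ Q X≤Y))))) ⟩
      60 + (Eᵗ + (Cᵗ + Y * (50 + Y * Q)))
        ≡⟨ cong₂ polynomial E≡ C≡ ⟨
      ⟦ runningTime pᵉ pᶜ ⟧ₚ ρ ∎
      where
      open ≤-Reasoning
      ρ = N ∷ t q ∷ n ^ q⋆ ∷ []
      Q = Best-R.Q
      E≡ : ⟦ substitute pᵉ (var (suc zero) ∷ var zero ∷ var zero ∷ []) ⟧ₚ ρ ≡ Eᵗ
      E≡ = ⟦substitute⟧ pᵉ (var (suc zero) ∷ var zero ∷ var zero ∷ []) ρ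
      C≡ : ⟦ substitute pᶜ (var (suc zero) ∷ var zero ∷ []) ⟧ₚ ρ ≡ Cᵗ
      C≡ = ⟦substitute⟧ pᶜ (var (suc zero) ∷ var zero ∷ []) ρ
      X = Best-R.B ^ q⋆
      Y = 6 * (n ^ q⋆) ^ 4
      polynomial : ℕ → ℕ → ℕ
      polynomial e c = 60 + (e + (c + Y * (50 + Y * (400 + (N * 100 + (N * 100 + (c + e)))))))
      regroup : ∀ a b e c w → a + (e + (c + 0)) + (b + (w + 0) + 0) ≡ a + b + (e + (c + w))
      regroup = solve-∀
      X≤Y : X ≤ Y
      X≤Y = branching-bound n q⋆ zero-variables one-variable
        where
        zero-variables : n ≡ 0 → q⋆ ≡ 0
        zero-variables refl = NaturalMetric.optimal-zero 𝓔 natural R ε q⋆ optimal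
        one-variable : n ≡ 1 → q⋆ ≤ 1
        one-variable refl = NaturalMetric.optimal-one 𝓔 natural R ε q⋆ optimal
      1+q⋆≤Y : suc q⋆ ≤ Y
      1+q⋆≤Y = ≤-trans (1+n≤2^n q⋆) (≤-trans (^-monoˡ-≤ q⋆ 2≤B) X≤Y)
        where
        2≤B : 2 ≤ 3 * suc n
        2≤B = ≤-trans (≤ᵇ⇒≤ 2 3 _) (m≤m*n 3 (suc n))

    main-run : ∀ {w s} →
      closure (Best-R.Search.searchEnv ⌜ encodeTree R ⌝ ⌜ describe R ⌝ (num ε)
        ⌜ cons (describe R) (num ε) ⌝ program middle outer) searchBody · nil ⇓ w ⟨ 0 ∣ s ∷ [] ⟩ →
      program · ⌜ cons (describe R) (num ε) ⌝ ⇓ w ⟨ 0 ∣ 50 + (s + 0) ∷ [] ⟩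
    main-run searches =
      relax 50 (enter (case-consᵂ varᵂ (case-consᵂ varᵂ (letᵂ funᵂ (appᵂ funᵂ nilᵂ searches))))) ≤-refl

    solve : ∃ λ (D : DDT n) → queryComplexity (tree D) ≤ q⋆ × OrderedField._≤_ F (value (𝓔 R D)) ε ×
      (instanceOpt Pᵉ Pᶜ on cons (describe R) (num ε) returns describe (tree D)
        within ⟦ runningTime pᵉ pᶜ ⟧ₚ (N ∷ t q ∷ n ^ q⋆ ∷ []))
    solve =
      let D , shallow , accurate , searches =
            Best-R.Top.search-run R R≤q ≤-refl ε ⌜ cons (describe R) (num ε) ⌝ program middle outer
              q⋆ optimal q⋆ 0 (+-identityʳ q⋆)
          answers = main-run searches
      in D , shallow , accurate ,
         run (evaluation loaded) (·evaluation answers) (time _ _ (bound loaded) (·bound answers))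
      where
      open _⊢_⇓_⟨_∣_⟩
      open _·_⇓_⟨_∣_⟩ renaming (evaluation to ·evaluation; bound to ·bound)

open import Data.Nat using (_^_) renaming (_≤_ to _≤ℕ_)

theorem3 : ∀ {a ℓ} (F : OrderedField a ℓ) → let open Over F in
    (𝓔 : ErrorMetric) (t : ℕ → ℕ) → Natural 𝓔 → Efficient t 𝓔 →
    ∃ λ (A : Program) → ∃ λ (p : Poly 3) →
    ∀ {n} q (R : RDT n) (ε : K) → queryComplexity R ≤ℕ q → 0# < ε → ε < 1# →
    ∀ q⋆ → IsOptimal 𝓔 R ε q⋆ →
    ∃ λ (D : DDT n) →
    queryComplexity (tree D) ≤ℕ q⋆ ×
    value (𝓔 R D) ≤ ε ×
    (A on cons (describe R) (num ε) returns describe (tree D)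
    within ⟦ p ⟧ₚ (descriptionLength R ∷ t q ∷ n ^ q⋆ ∷ []))
theorem3 F 𝓔 t natural ((Pᵉ , pᵉ , computesE) , (Pᶜ , pᶜ , computesC)) =
  instanceOpt Pᵉ Pᶜ , runningTime pᵉ pᶜ , λ q R ε R≤q _ _ →
    InstanceOpt.solve F 𝓔 t natural Pᵉ Pᶜ pᵉ pᶜ computesE computesC q R ε R≤q
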